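{- Let $D$ be a full $1$-extension of a directed path, with added vertex $s$. If $s$ is a source or a sink of $D$, or if $D$ is $TT_3$, then $\mathrm{unv}(D)=2|V(D)|-2$. Otherwise $\mathrm{unv}(D)=2|V(D)|-3$.
   Context: A full $1$-extension of a directed path $P$ is an acyclic digraph $D$ with a vertex $s$ (the added vertex) such that $D-s=P$ and $s$ is adjacent (by an arc in one direction) to every vertex of $P$. $TT_3$ is the transitive tournament on 3 vertices. A digraph is $p$-unavoidable if it is contained in (isomorphic to a subdigraph of) every tournament of order $p$; $\mathrm{unv}(D)$ is the least such $p$. -}

module Defs where

open import Data.Nat using (ℕ; zero; suc; _<_)
open import Data.Fin using (Fin; zero; suc; toℕ)
open import Data.Bool using (Bool; true; false; not)
open import Data.Product using (Σ; _×_; _,_)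
open import Data.Sum using (_⊎_)
open import Relation.Nullary using (¬_)
open import Relation.Binary.PropositionalEquality using (_≡_)
open import Function.Definitions using (Injective)

Digraph : ℕ → Set
Digraph n = Fin n → Fin n → Bool

Arc : ∀ {n} → Digraph n → Fin n → Fin n → Set
Arc D u v = D u v ≡ true

IsTournament : ∀ {n} → Digraph n → Set
IsTournament {n} T =
  (∀ u → ¬ Arc T u u) ×
  (∀ u v → ¬ u ≡ v → (Arc T u v ⊎ Arc T v u)) ×
  (∀ u v → Arc T u v → ¬ Arc T v u)

_⊑_ : ∀ {m k} → Digraph m → Digraph k → Set
_⊑_ {m} {k} D E =
  Σ (Fin m → Fin k) λ f → Injective _≡_ _≡_ f × (∀ u v → Arc D u v → Arc E (f u) (f v))

Unavoidable : ∀ {m} → Digraph m → ℕ → Set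
Unavoidable D p = (T : Digraph p) → IsTournament T → D ⊑ T

IsUnv : ∀ {m} → Digraph m → ℕ → Set
IsUnv D p = Unavoidable D p × (∀ q → q < p → ¬ Unavoidable D q)

data Walk {n} (D : Digraph n) : Fin n → Fin n → ℕ → Set where
  here : ∀ {u} → Walk D u u zero
  step : ∀ {u v w k} → Arc D u v → Walk D v w k → Walk D u w (suc k)

Acyclic : ∀ {n} → Digraph n → Set
Acyclic D = ∀ u k → ¬ Walk D u u (suc k)

_≅_ : ∀ {m k} → Digraph m → Digraph k → Set
_≅_ {m} {k} D E =
  Σ (Fin m → Fin k) λ f → Σ (Fin k → Fin m) λ g →
    (∀ x → g (f x) ≡ x) × (∀ y → f (g y) ≡ y) ×
    (∀ u v → Arc D u v → Arc E (f u) (f v)) ×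
    (∀ u v → Arc E (f u) (f v) → Arc D u v)

TT3 : Digraph 3
TT3 zero     (suc _)        = true
TT3 (suc zero) (suc (suc zero)) = true
TT3 _        _              = false

-- The directed path on n vertices: i → i+1.
-- The full 1-extension of it determined by o : Fin n → Bool.
-- Vertex set Fin (suc n): the added vertex s is zero, path vertex i is suc i.
-- o i ≡ true means s → i, o i ≡ false means i → s.
succ? : ∀ {n} → Fin n → Fin n → Bool
succ? i j with toℕ j Data.Nat.≟ suc (toℕ i)
... | Relation.Nullary.yes _ = true
... | Relation.Nullary.no  _ = false

Ext : ∀ {n} → (Fin n → Bool) → Digraph (suc n)
Ext o zero    zero    = false
Ext o zero    (suc j) = o j
Ext o (suc i) zero    = not (o i)
Ext o (suc i) (suc j) = succ? i j

Source : ∀ {n} → Digraph n → Fin n → Set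
Source D s = ∀ v → ¬ Arc D v s

Sink : ∀ {n} → Digraph n → Fin n → Set
Sink D s = ∀ v → ¬ Arc D s v

{-# OPTIONS --safe #-}
module Submission where

-- Acyclicity forces the vertices p₀ , … , pₙ₋₁ of the path to split: the first a are in-neighbours
-- of s, the other b = n − a are out-neighbours.
--
-- If a = 0 or b = 0, a tournament on 2n vertices has a vertex of out-degree (in-degree) at least n,
-- whose neighbourhood contains a path on n vertices; regular tournaments on 2n − 1 vertices have none.
--
-- If a, b ≥ 1 and n ≥ 3, let T have 2n − 1 vertices and contain no copy of the extension. For a vertex
-- s with d⁻(s) ≥ a and d⁺(s) ≥ b split N⁻(s) = E ∪ X, where E consists of the ends of paths of a
-- vertices, X dominates E and |X| < a; dually N⁺(s) = S ∪ Y with |Y| < b. Then S dominates E.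
-- If |E| + |Y| ≥ b, then every t in S has d⁻(t) < a, since otherwise there is a copy, usually centred at t;
-- if |X| + |S| ≥ a, then dually every t in E has d⁺(t) < b; and one of the two cases occurs.
-- So the vertex set is U ∪ W, where each vertex of U has fewer than b out-neighbours in U and each
-- vertex of W has fewer than a in-neighbours in W. Hence |U| ≤ 2b − 1 and |W| ≤ 2a − 1, which is
-- less than 2n − 1 in total. For the lower bound, let a regular tournament on 2a − 1 vertices
-- dominate a regular tournament on 2b − 1 vertices.

open import Defs
open import Data.Bool using (Bool; true; false; not)
import Data.Bool as Bool
open import Data.Bool.Properties using (not-involutive)
open import Data.Fin using (Fin; zero; suc; toℕ; fromℕ<; _↑ˡ_; _↑ʳ_)
open import Data.Fin.Properties as Fin
  using (toℕ-injective; toℕ<n; toℕ-fromℕ<; toℕ-↑ˡ; toℕ-↑ʳ; ↑ˡ-injective; ↑ʳ-injective;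
         injective⇒≤; fromℕ<-injective)
open import Data.List.Base
  using (List; []; _∷_; _++_; _ʳ++_; length; lookup; filter; map; take; reverse; allFin)
open import Data.List.Properties
  using (length-++; ++-identityʳ; ++-assoc; ʳ++-defn; length-take; take-[]; length-reverse;
         length-tabulate; length-filter; filter-all; filter-none; filter-accept; filter-reject;
         filter-complete; filter-++)
open import Data.List.Membership.Propositional using (_∈_; _∉_; find; lose)
open import Data.List.Membership.Propositional.Properties
  using (∈-∃++; ∈-++⁺ˡ; ∈-++⁺ʳ; ∈-++⁻; ∈-filter⁺; ∈-filter⁻; ∈-lookup)
open import Data.List.Relation.Unary.All as All using (All; []; _∷_)
open import Data.List.Relation.Unary.All.Properties as All using (¬Any⇒All¬)
open import Data.List.Relation.Unary.AllPairs using ([]; _∷_)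
open import Data.List.Relation.Unary.Any using (Any; here; there; any?)
open import Data.List.Relation.Unary.Linked using (Linked; []; [-]; _∷_)
open import Data.List.Relation.Unary.Unique.Propositional using (Unique)
open import Data.List.Relation.Unary.Unique.Propositional.Properties as Unique
  using (Unique[x∷xs]⇒x∉xs)
open import Data.List.Relation.Binary.Permutation.Propositional
  using (_↭_; refl; prep; swap; trans; ↭-sym; ↭-reflexive; ↭⇒↭ₛ)
open import Data.List.Relation.Binary.Permutation.Propositional.Properties
  using (∈-resp-↭; ↭-length; ↭-reverse; filter-↭; shift; shifts; ++-comm; ++⁺; ++⁺ˡ; ++⁺ʳ; All-resp-↭)
import Data.List.Relation.Binary.Permutation.Setoid.Properties as Permutationₛ
open import Data.Nat
  using (ℕ; zero; suc; pred; _+_; _*_; _∸_; _≤_; _<_; z≤n; s≤s; _≟_; _≤?_; _<?_)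
open import Data.Nat.ListAction using (sum)
open import Data.Nat.Properties hiding (_≟_; _≤?_; _<?_)
open import Data.Nat.Tactic.RingSolver using (solve-∀)
open import Data.Product using (∃; ∃₂; _×_; _,_; proj₁; proj₂)
open import Data.Sum as Sum using (_⊎_; inj₁; inj₂)
open import Function using (_∘_; flip; id)
open import Function.Definitions using (Injective)
open import Relation.Binary using (Decidable)
open import Relation.Nullary using (¬_; Dec; yes; no; contradiction; ¬?)
open import Relation.Unary using (Pred)
open import Relation.Binary.PropositionalEquality
  using (_≡_; _≢_; refl; sym; cong; cong₂; subst; subst₂; setoid; ≢-sym; module ≡-Reasoning)
  renaming (trans to ≡-trans)

private
  variable
    A V : Set
    n : ℕ

-- Repetition-free lists and permutations.

Unique-resp-↭ : {xs ys : List A} → xs ↭ ys → Unique xs → Unique ys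
Unique-resp-↭ p = Permutationₛ.Unique-resp-↭ (setoid _) (↭⇒↭ₛ p)

Unique-++⁻ˡ : ∀ (xs : List A) {ys} → Unique (xs ++ ys) → Unique xs
Unique-++⁻ˡ []       _        = []
Unique-++⁻ˡ (x ∷ xs) (px ∷ u) = All.++⁻ˡ xs px ∷ Unique-++⁻ˡ xs u

Unique-++⁻ʳ : ∀ (xs : List A) {ys} → Unique (xs ++ ys) → Unique ys
Unique-++⁻ʳ []       u       = u
Unique-++⁻ʳ (x ∷ xs) (_ ∷ u) = Unique-++⁻ʳ xs u

Unique-tail : {x : A} {xs : List A} → Unique (x ∷ xs) → Unique xs
Unique-tail (_ ∷ u) = u

Unique-++⁻-disjoint : ∀ (xs : List A) {ys x} → Unique (xs ++ ys) → x ∈ xs → x ∉ ys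
Unique-++⁻-disjoint (x ∷ xs) u       (here refl) x∈ys = Unique[x∷xs]⇒x∉xs u (∈-++⁺ʳ xs x∈ys)
Unique-++⁻-disjoint (_ ∷ xs) (_ ∷ u) (there x∈)  x∈ys = Unique-++⁻-disjoint xs u x∈ x∈ys

Unique-∷⁺ : {x : A} {xs : List A} → x ∉ xs → Unique xs → Unique (x ∷ xs)
Unique-∷⁺ x∉xs u = All.tabulate (λ y∈xs eq → x∉xs (subst (_∈ _) (sym eq) y∈xs)) ∷ u

∈⇒↭ : {x : A} {xs : List A} → x ∈ xs → ∃ λ ys → xs ↭ x ∷ ys
∈⇒↭ {x = x} x∈xs with ys , zs , refl ← ∈-∃++ x∈xs = ys ++ zs , shift x ys zs

-- `Q` stands for an outcome that ends a search, such as a copy of the extension: finding it at one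
-- vertex is enough, and otherwise every vertex has the local property.
all⊎ : {P : A → Set} {Q : Set} (xs : List A) →
       (∀ {x} → x ∈ xs → P x ⊎ Q) → (∀ {x} → x ∈ xs → P x) ⊎ Q
all⊎ []       f = inj₁ λ ()
all⊎ (x ∷ xs) f with f (here refl) | all⊎ xs (f ∘ there)
... | inj₂ q | _      = inj₂ q
... | inj₁ _ | inj₂ q = inj₂ q
... | inj₁ p | inj₁ g = inj₁ λ { (here refl) → p ; (there x∈xs) → g x∈xs }

separate : {P Q : A → Set} (xs : List A) → (∀ {x} → x ∈ xs → P x ⊎ Q x) →
           ∃₂ λ ys zs → ys ++ zs ↭ xs × All P ys × All Q zs
separate []       f = [] , [] , refl , [] , []
separate (x ∷ xs) f with separate xs (f ∘ there) | f (here refl)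
... | ys , zs , p , ps , qs | inj₁ px = x ∷ ys , zs , prep x p , px ∷ ps , qs
... | ys , zs , p , ps , qs | inj₂ qx = ys , x ∷ zs , trans (shift x ys zs) (prep x p) , ps , qx ∷ qs

-- Tournaments, their reversal, and the two halves of the path.

record Tournament (V : Set) : Set₁ where
  infix 4 _⟶_ _⟶?_ _⇉_
  field
    _⟶_    : V → V → Set
    _⟶?_   : Decidable _⟶_
    asym   : ∀ {u v} → u ⟶ v → ¬ v ⟶ u
    connex : ∀ {u v} → u ≢ v → u ⟶ v ⊎ v ⟶ u

  irrefl : ∀ {u} → ¬ u ⟶ u
  irrefl u⟶u = asym u⟶u u⟶u

  _⇉_ : List V → List V → Set
  X ⇉ Y = ∀ {x y} → x ∈ X → y ∈ Y → x ⟶ y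

  out in′ : V → List V → List V
  out v = filter (v ⟶?_)
  in′ v = filter (_⟶? v)

infix 8 _ᵒᵖ
-- Since arcs form a relation, reversal is `flip`, and `out` of the reversed tournament computes to
-- `in′`; dual statements are instances at `T ᵒᵖ`.
_ᵒᵖ : Tournament V → Tournament V
T ᵒᵖ = record
  { _⟶_    = flip _⟶_
  ; _⟶?_   = flip _⟶?_
  ; asym   = asym
  ; connex = connex ∘ ≢-sym
  } where open Tournament T

-- A lower bound on the length suffices: surplus vertices are cut off at the far end when the copy
-- is assembled.
Ray : (V → V → Set) → (V → Set) → ℕ → V → Set
Ray R P b v = ∃ λ q →
  Linked R (v ∷ q) × Unique (v ∷ q) × b ≤ length (v ∷ q) × All P (v ∷ q)

-- The in-part u ∷ p of the path is listed backwards from u, so that reversing all arcs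
-- exchanges the two rays.
Extension : (V → V → Set) → ℕ → ℕ → Set
Extension R a b = ∃ λ s → ∃₂ λ u v →
  Ray (flip R) (flip R s) a u × Ray R (R s) b v × R u v

Extension-op : ∀ {R : V → V → Set} {a b} → Extension (flip R) b a → Extension R a b
Extension-op (s , u , v , p , q , r) = s , v , u , q , p , r

-- Paths in tournaments.

module Paths (T : Tournament V) where
  open Tournament T

  linked-++∷ : ∀ {xs y ys} → Linked _⟶_ xs → (∀ {x} → x ∈ xs → x ⟶ y) → Linked _⟶_ (y ∷ ys) →
               Linked _⟶_ (xs ++ y ∷ ys)
  linked-++∷ []        _ l = l
  linked-++∷ [-]       r l = r (here refl) ∷ l
  linked-++∷ (x⟶y ∷ k) r l = x⟶y ∷ linked-++∷ k (r ∘ there) l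

  linked-++ : ∀ {xs ys} → Linked _⟶_ xs → Linked _⟶_ ys → xs ⇉ ys → Linked _⟶_ (xs ++ ys)
  linked-++ {xs} {[]}    k _ _ = subst (Linked _⟶_) (sym (++-identityʳ xs)) k
  linked-++ {xs} {_ ∷ _} k l r = linked-++∷ k (λ x∈ → r x∈ (here refl)) l

  -- From a vertex dominating `w`, pass along the path as long as the next vertex dominates `w` as
  -- well, and put `w` there. It always lands behind some vertex, so the head `c` stays first.
  insert : ∀ {c cs w} → Linked _⟶_ (c ∷ cs) → Any (_⟶ w) (c ∷ cs) → All (w ≢_) (c ∷ cs) →
           ∃ λ ds → Linked _⟶_ (c ∷ ds) × ds ↭ w ∷ cs
  insert {cs = []}     [-]      (here c⟶w) _ = _ ∷ [] , c⟶w ∷ [-] , refl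
  insert {cs = d ∷ ds} {w} (c⟶d ∷ l) (here c⟶w) (_ ∷ w∉@(w≢d ∷ _)) with connex w≢d
  ... | inj₁ w⟶d = w ∷ d ∷ ds , c⟶w ∷ w⟶d ∷ l , refl
  ... | inj₂ d⟶w with es , k , p ← insert l (here d⟶w) w∉ =
    d ∷ es , c⟶d ∷ k , trans (prep d p) (swap d w refl)
  insert {cs = d ∷ ds} {w} (c⟶d ∷ l) (there any) (_ ∷ w∉)
    with es , k , p ← insert l any w∉ = d ∷ es , c⟶d ∷ k , trans (prep d p) (swap d w refl)

  -- Rédei's theorem, that a tournament has a Hamiltonian path, by induction: `w` is inserted behind
  -- a vertex dominating it, and if there is none, `w` dominates the head and goes in front.
  rédei : ∀ {L} → Unique L → ∃ λ P → Linked _⟶_ P × P ↭ L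
  rédei []               = [] , [] , refl
  rédei {w ∷ L} (w∉L ∷ u) with rédei u
  ... | []     , _ , p = w ∷ [] , [-] , prep w p
  ... | c ∷ cs , l , p with any? (_⟶? w) (c ∷ cs)
  ...   | yes any with ds , k , q ← insert l any (All-resp-↭ (↭-sym p) w∉L) =
    c ∷ ds , k , trans (prep c q) (trans (swap c w refl) (prep w p))
  ...   | no ¬any with connex (All.lookup w∉L (∈-resp-↭ p (here refl)))
  ...     | inj₁ w⟶c = w ∷ c ∷ cs , w⟶c ∷ l , prep w p
  ...     | inj₂ c⟶w = contradiction (here c⟶w) ¬any

  -- C′ is a maximal path from v inside C ++ R: a vertex outside it that were dominated by
  -- a vertex of the path could be inserted.
  reach : ∀ {v} C R → length R ≤ n → Unique (v ∷ C ++ R) → Linked _⟶_ (v ∷ C) →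
          ∃₂ λ C′ R′ → Linked _⟶_ (v ∷ C′) × C′ ++ R′ ↭ C ++ R × R′ ⇉ v ∷ C′
  reach {n} {v} C R R≤n u l with any? (λ w → any? (_⟶? w) (v ∷ C)) R
  ... | no ¬any = C , R , l , refl , R⇉
    where
    disjoint : ∀ {x c} → x ∈ R → c ∈ v ∷ C → c ≢ x
    disjoint x∈R (here refl) refl = Unique[x∷xs]⇒x∉xs u (∈-++⁺ʳ C x∈R)
    disjoint x∈R (there c∈C) refl = Unique-++⁻-disjoint C (Unique-tail u) c∈C x∈R
    R⇉ : R ⇉ v ∷ C
    R⇉ x∈R c∈C with connex (disjoint x∈R c∈C)
    ... | inj₁ c⟶x = contradiction (lose x∈R (lose c∈C c⟶x)) ¬any
    ... | inj₂ x⟶c = x⟶c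
  ... | yes any with w , w∈R , v⇝w ← find any
                with R₀ , p ← ∈⇒↭ w∈R
                with n | R≤n | ↭-length p
  ...   | zero  | R≤0 | eq = contradiction (subst (_≤ 0) eq R≤0) λ ()
  ...   | suc m | R≤n | eq
    with C+R↭ ← trans (++⁺ˡ C p) (shift w C R₀)
    with w∉ ∷ _ ← Unique-resp-↭ (trans (prep v C+R↭) (swap v w refl)) u
    with D , k , q ← insert l v⇝w (All.++⁻ˡ (v ∷ C) w∉)
    with D+R₀↭ ← trans (++⁺ʳ R₀ q) (↭-sym C+R↭)
    with C′ , R′ , k′ , q′ , d ← reach D R₀ (≤-pred (subst (_≤ suc m) eq R≤n))
                                       (Unique-resp-↭ (prep v (↭-sym D+R₀↭)) u) k
    = C′ , R′ , k′ , trans q′ D+R₀↭ , d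

  ray-mono : ∀ {P Q : V → Set} {b v} → (∀ {x} → P x → Q x) → Ray _⟶_ P b v → Ray _⟶_ Q b v
  ray-mono f (q , l , u , b , ps) = q , l , u , b , All.map f ps

  -- For `v` in `S`, let `v ∷ C` be a path in `S` dominated by the rest `R` of `S` (`reach`).
  -- Followed by a Hamiltonian path of `Y` it is a ray from `v`, unless both together have fewer
  -- than `b` vertices. In that case they form the new `Y`, dominated by the new and smaller `S`,
  -- which is `R`. The process starts from `S = H` and empty `Y`.
  decompose : ∀ {b} H → 1 ≤ b → Unique H →
              ∃₂ λ S Y → S ++ Y ↭ H × S ⇉ Y × length Y < b ×
                         (∀ {v} → v ∈ S → Ray _⟶_ (_∈ H) b v)
  decompose {b} H 1≤b uH = grow (length H) H [] ≤-refl (↭-reflexive (++-identityʳ H)) (λ _ ()) 1≤b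
    where
    Larger : ℕ → Set
    Larger n = ∃₂ λ S Y → length S < n × S ++ Y ↭ H × S ⇉ Y × length Y < b

    module _ {n S Y} (S≤n : length S ≤ n) (S++Y↭H : S ++ Y ↭ H) (S⇉Y : S ⇉ Y)
             {v C R} (l : Linked _⟶_ (v ∷ C)) (C++R↭S : v ∷ C ++ R ↭ S) (R⇉C : R ⇉ v ∷ C) where

      rearrange : R ++ v ∷ C ++ Y ↭ H
      rearrange = trans (shifts R (v ∷ C)) (trans (↭-reflexive (sym (++-assoc (v ∷ C) R Y)))
                    (trans (++⁺ʳ Y C++R↭S) S++Y↭H))

      uCY : Unique (v ∷ C ++ Y)
      uCY = Unique-++⁻ʳ R (Unique-resp-↭ (↭-sym rearrange) uH)

      extend : b ≤ length (v ∷ C ++ Y) → Ray _⟶_ (_∈ H) b v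
      extend b≤ with Q , k , t ← rédei (Unique-++⁻ʳ (v ∷ C) uCY)
        with CY↭CQ ← prep v (++⁺ˡ C (↭-sym t)) =
        C ++ Q ,
        linked-++ l k (λ x∈ y∈ → S⇉Y (∈-resp-↭ C++R↭S (∈-++⁺ˡ x∈)) (∈-resp-↭ t y∈)) ,
        Unique-resp-↭ CY↭CQ uCY ,
        subst (b ≤_) (↭-length CY↭CQ) b≤ ,
        All.tabulate (λ x∈ → ∈-resp-↭ rearrange (∈-++⁺ʳ R (∈-resp-↭ (↭-sym CY↭CQ) x∈)))

      R<n : length R < n
      R<n = ≤-trans (s≤s (m≤n+m (length R) (length C)))
        (≤-trans (≤-reflexive (≡-trans (cong suc (sym (length-++ C))) (↭-length C++R↭S))) S≤n)

      R⇉CY : R ⇉ v ∷ C ++ Y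
      R⇉CY x∈R y∈ with ∈-++⁻ (v ∷ C) y∈
      ... | inj₁ y∈C = R⇉C x∈R y∈C
      ... | inj₂ y∈Y = S⇉Y (∈-resp-↭ C++R↭S (∈-++⁺ʳ (v ∷ C) x∈R)) y∈Y

      ray⊎larger : Ray _⟶_ (_∈ H) b v ⊎ Larger n
      ray⊎larger with b ≤? length (v ∷ C ++ Y)
      ... | yes b≤ = inj₁ (extend b≤)
      ... | no b≰  = inj₂ (R , v ∷ C ++ Y , R<n , rearrange , R⇉CY , ≰⇒> b≰)

    search : ∀ {n S Y} → length S ≤ n → S ++ Y ↭ H → S ⇉ Y →
             ∀ {v} → v ∈ S → Ray _⟶_ (_∈ H) b v ⊎ Larger n
    search {S = S} S≤n p S⇉Y v∈S
      with S₀ , q ← ∈⇒↭ v∈S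
      with C , R , l , r , R⇉C ← reach [] S₀ ≤-refl
             (Unique-resp-↭ q (Unique-++⁻ˡ S (Unique-resp-↭ (↭-sym p) uH))) [-]
      = ray⊎larger S≤n p S⇉Y l (trans (prep _ r) (↭-sym q)) R⇉C

    grow : ∀ n S Y → length S ≤ n → S ++ Y ↭ H → S ⇉ Y → length Y < b →
           ∃₂ λ S Y → S ++ Y ↭ H × S ⇉ Y × length Y < b ×
                      (∀ {v} → v ∈ S → Ray _⟶_ (_∈ H) b v)
    grow n S Y S≤n p S⇉Y Y<b with all⊎ S (search S≤n p S⇉Y)
    ... | inj₁ rays = S , Y , p , S⇉Y , Y<b , rays
    grow (suc n) _ _ _ _ _ _ | inj₂ (S , Y , S<n , p , S⇉Y , Y<b) =
      grow n S Y (≤-pred S<n) p S⇉Y Y<b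

-- Counting arcs.

module Degrees (T : Tournament V) where
  open Tournament T

  out-in : ∀ {s L} → s ∉ L → out s L ++ in′ s L ↭ L
  out-in {L = []} _ = refl
  out-in {s} {x ∷ L} s∉ with connex {s} {x} (λ { refl → s∉ (here refl) })
  ... | inj₁ s⟶x
    rewrite filter-accept (s ⟶?_) {xs = L} s⟶x | filter-reject (_⟶? s) {xs = L} (asym s⟶x)
    = prep x (out-in (s∉ ∘ there))
  ... | inj₂ x⟶s
    rewrite filter-accept (_⟶? s) {xs = L} x⟶s | filter-reject (s ⟶?_) {xs = L} (asym x⟶s)
    = trans (shift x (out s L) (in′ s L)) (prep x (out-in (s∉ ∘ there)))

  arcs : List V → List V → ℕ
  arcs X W = sum (map (λ x → length (out x W)) X)

  private
    exchange : ∀ i j k → i + (j + k) ≡ j + (i + k)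
    exchange = solve-∀

  -- Splits off a column of the arc matrix, where the definition of `arcs` splits off a row.
  arcs-∷ : ∀ X w W → arcs X (w ∷ W) ≡ length (in′ w X) + arcs X W
  arcs-∷ []      w W = refl
  arcs-∷ (x ∷ X) w W with x ⟶? w
  ... | yes _ = cong suc (≡-trans (cong (length (out x W) +_) (arcs-∷ X w W))
                  (exchange (length (out x W)) (length (in′ w X)) (arcs X W)))
  ... | no _  = ≡-trans (cong (length (out x W) +_) (arcs-∷ X w W))
                  (exchange (length (out x W)) (length (in′ w X)) (arcs X W))

  -- The count `n(n − 1)/2` of arcs, freed of subtraction and division. Removing `w` removes its row
  -- and its column, which by `out-in` hold one arc for each other vertex.
  arcs-square : ∀ {W} → Unique W → arcs W W + arcs W W + length W ≡ length W * length W
  arcs-square []                    = refl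
  arcs-square {w ∷ W} u@(_ ∷ uW) = begin
    arcs (w ∷ W) (w ∷ W) + arcs (w ∷ W) (w ∷ W) + suc (length W)
      ≡⟨ cong (λ e → e + e + suc (length W)) arcs-W ⟩
    (length W + arcs W W) + (length W + arcs W W) + suc (length W)
      ≡⟨ regroup (length W) (arcs W W) ⟩
    (arcs W W + arcs W W + length W) + (length W + length W + 1)
      ≡⟨ cong (_+ (length W + length W + 1)) (arcs-square uW) ⟩
    length W * length W + (length W + length W + 1)
      ≡⟨ square (length W) ⟩
    suc (length W) * suc (length W) ∎
    where
    open ≡-Reasoning
    regroup : ∀ l e → (l + e) + (l + e) + suc l ≡ (e + e + l) + (l + l + 1)
    regroup = solve-∀
    square : ∀ l → l * l + (l + l + 1) ≡ suc l * suc l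
    square = solve-∀
    arcs-W : arcs (w ∷ W) (w ∷ W) ≡ length W + arcs W W
    arcs-W = begin
      length (out w (w ∷ W)) + arcs W (w ∷ W)
        ≡⟨ cong₂ _+_ (cong length (filter-reject (w ⟶?_) irrefl)) (arcs-∷ W w W) ⟩
      length (out w W) + (length (in′ w W) + arcs W W)
        ≡⟨ +-assoc (length (out w W)) _ _ ⟨
      length (out w W) + length (in′ w W) + arcs W W
        ≡⟨ cong (_+ arcs W W) (length-++ (out w W)) ⟨
      length (out w W ++ in′ w W) + arcs W W
        ≡⟨ cong (_+ arcs W W) (↭-length (out-in (Unique[x∷xs]⇒x∉xs u))) ⟩
      length W + arcs W W ∎

  -- Averaging: if all out-degrees were below `a`, then `2·arcs + 2|W| ≤ 2a|W| ≤ |W|² = 2·arcs +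
  -- |W|`, which makes `W` empty.
  largeOutdegree : ∀ {a W} → 1 ≤ a → Unique W → a + a ≤ length W →
                   ∃ λ w → w ∈ W × a ≤ length (out w W)
  largeOutdegree {a} {W} 1≤a u 2a≤ with any? (λ w → a ≤? length (out w W)) W
  ... | yes any = find any
  ... | no ¬any = contradiction impossible (<⇒≱ (≤-trans 1≤a (≤-trans (m≤m+n a a) 2a≤)))
    where
    bound : ∀ {X} → All (λ w → ¬ a ≤ length (out w W)) X → arcs X W + length X ≤ length X * a
    bound []                    = z≤n
    bound {x ∷ X} (x< ∷ xs<) =
      subst (_≤ a + length X * a) (regroup (length (out x W)) (arcs X W) (length X))
            (+-mono-≤ (≰⇒> x<) (bound xs<))
      where
      regroup : ∀ o e l → suc o + (e + l) ≡ (o + e) + suc l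
      regroup = solve-∀
    open ≤-Reasoning
    impossible : length W ≤ 0
    impossible = +-cancelˡ-≤ (arcs W W + arcs W W + length W) _ _ (begin
      (arcs W W + arcs W W + length W) + length W   ≡⟨ regroup (arcs W W) (length W) ⟩
      (arcs W W + length W) + (arcs W W + length W) ≤⟨ +-mono-≤ (bound ≮) (bound ≮) ⟩
      length W * a + length W * a                   ≡⟨ *-distribˡ-+ (length W) a a ⟨
      length W * (a + a)                            ≤⟨ *-monoʳ-≤ (length W) 2a≤ ⟩
      length W * length W                           ≡⟨ arcs-square u ⟨
      arcs W W + arcs W W + length W                ≡⟨ +-identityʳ _ ⟨
      (arcs W W + arcs W W + length W) + 0          ∎)
      where
      ≮ : All (λ w → ¬ a ≤ length (out w W)) W
      ≮ = ¬Any⇒All¬ W ¬any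
      regroup : ∀ e l → (e + e + l) + l ≡ (e + l) + (e + l)
      regroup = solve-∀

  -- Some vertex has out-degree at least 2 in `Z`, and two of its out-neighbours are adjacent. A
  -- cyclic triangle contains no such triple, hence the bound 4.
  transitiveTriple : ∀ {Z} → Unique Z → 4 ≤ length Z →
    ∃ λ u → ∃₂ λ c w → u ∈ Z × c ∈ Z × w ∈ Z × u ⟶ c × c ⟶ w × u ⟶ w
  transitiveTriple {Z} uZ 4≤ with u , u∈ , 2≤ ← largeOutdegree {2} (s≤s z≤n) uZ 4≤
    = pick (out u Z) (Unique.filter⁺ (u ⟶?_) uZ) 2≤ (∈-filter⁻ (u ⟶?_))
    where
    pick : ∀ O → Unique O → 2 ≤ length O → (∀ {x} → x ∈ O → x ∈ Z × u ⟶ x) →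
      ∃ λ u → ∃₂ λ c w → u ∈ Z × c ∈ Z × w ∈ Z × u ⟶ c × c ⟶ w × u ⟶ w
    pick (_ ∷ []) _ (s≤s ()) _
    pick (x ∷ y ∷ _) ((x≢y ∷ _) ∷ _) _ f
      with x∈ , u⟶x ← f (here refl) | y∈ , u⟶y ← f (there (here refl)) with connex x≢y
    ... | inj₁ x⟶y = u , x , y , u∈ , x∈ , y∈ , u⟶x , x⟶y , u⟶y
    ... | inj₂ y⟶x = u , y , x , u∈ , y∈ , x∈ , u⟶y , y⟶x , u⟶x

-- Blocked vertices: copies found near a vertex that is not itself a centre.

Small : (T : Tournament V) → List V → ℕ → V → Set
Small T L b v = length (Tournament.out T v L) < b

-- The partition N⁻(s) = E ∪ X, N⁺(s) = S ∪ Y left over when no arc from E to S completes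
-- a copy centred at s.
record Blocked (T : Tournament V) (L : List V) (a b : ℕ) (s : V) (X E S Y : List V) : Set where
  open Tournament T
  field
    perm   : s ∷ (E ++ X) ++ (S ++ Y) ↭ L
    unique : Unique L
    size   : suc (length L) ≡ (a + b) + (a + b)
    3≤a+b  : 3 ≤ a + b
    1≤a    : 1 ≤ a
    1≤b    : 1 ≤ b
    before : ∀ {x} → x ∈ E ++ X → x ⟶ s
    after  : ∀ {y} → y ∈ S ++ Y → s ⟶ y
    X⇉E    : X ⇉ E
    S⇉Y    : S ⇉ Y
    S⇉E    : S ⇉ E
    X<a    : length X < a
    Y<b    : length Y < b
    a≤EX   : a ≤ length (E ++ X)
    b≤SY   : b ≤ length (S ++ Y)

-- Reversal exchanges `E` with `S` and `X` with `Y`, so `Key` has to treat only one of the two cases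
-- on sizes.
blocked-op : ∀ {T : Tournament V} {L a b s X E S Y} →
             Blocked T L a b s X E S Y → Blocked (T ᵒᵖ) L b a s Y S E X
blocked-op {L = L} {a} {b} {s} {X} {E} {S} {Y} B = record
  { perm   = trans (prep s (++-comm (S ++ Y) (E ++ X))) perm
  ; unique = unique
  ; size   = subst (λ k → suc (length L) ≡ k + k) (+-comm a b) size
  ; 3≤a+b  = subst (3 ≤_) (+-comm a b) 3≤a+b
  ; 1≤a = 1≤b ; 1≤b = 1≤a
  ; before = after ; after = before
  ; X⇉E = λ y∈ s∈ → S⇉Y s∈ y∈
  ; S⇉Y = λ e∈ x∈ → X⇉E x∈ e∈
  ; S⇉E = λ e∈ s∈ → S⇉E s∈ e∈
  ; X<a = Y<b ; Y<b = X<a ; a≤EX = b≤SY ; b≤SY = a≤EX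
  } where open Blocked B

-- Every `t` in `S` dominates the at least `b` vertices of `E ∪ Y`, so `t` is the natural centre of
-- a copy, lacking only the in-part and the joining arc. The in-neighbours of `t` are `s` and
-- vertices of `X` and `S`; which of these exist decides the case.
module Key (T : Tournament V) {L a b s X E S Y} (B : Blocked T L a b s X E S Y)
           (b≤E+Y : b ≤ length E + length Y) where
  open Tournament T
  open Blocked B
  module Out = Paths T
  module In  = Paths (T ᵒᵖ)

  uL : Unique (s ∷ (E ++ X) ++ (S ++ Y))
  uL = Unique-resp-↭ (↭-sym perm) unique

  uE : Unique E
  uE = Unique-++⁻ˡ E (Unique-++⁻ˡ (E ++ X) (Unique-tail uL))
  uX : Unique X
  uX = Unique-++⁻ʳ E (Unique-++⁻ˡ (E ++ X) (Unique-tail uL))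
  uS : Unique S
  uS = Unique-++⁻ˡ S (Unique-++⁻ʳ (E ++ X) (Unique-tail uL))
  uY : Unique Y
  uY = Unique-++⁻ʳ S (Unique-++⁻ʳ (E ++ X) (Unique-tail uL))

  E⟶s : ∀ {x} → x ∈ E → x ⟶ s
  E⟶s = before ∘ ∈-++⁺ˡ
  X⟶s : ∀ {x} → x ∈ X → x ⟶ s
  X⟶s = before ∘ ∈-++⁺ʳ E
  s⟶S : ∀ {x} → x ∈ S → s ⟶ x
  s⟶S = after ∘ ∈-++⁺ˡ
  s⟶Y : ∀ {x} → x ∈ Y → s ⟶ x
  s⟶Y = after ∘ ∈-++⁺ʳ S

  uEY : Unique (E ++ Y)
  uEY = Unique.++⁺ uE uY λ { (e∈E , e∈Y) → asym (E⟶s e∈E) (s⟶Y e∈Y) }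

  S⇉EY : S ⇉ E ++ Y
  S⇉EY x∈ y∈ with ∈-++⁻ E y∈
  ... | inj₁ y∈E = S⇉E x∈ y∈E
  ... | inj₂ y∈Y = S⇉Y x∈ y∈Y

  b≤EY : b ≤ length (E ++ Y)
  b≤EY = ≤-trans b≤E+Y (≤-reflexive (sym (length-++ E)))

  module _ {t} (t∈S : t ∈ S) where

    -- `t` dominates `E` and `Y`, so these drop out; the extra one is `s`.
    in-t : length (in′ t L) ≡ suc (length (in′ t X) + length (in′ t S))
    in-t = begin
      length (in′ t L)
        ≡⟨ ↭-length (filter-↭ (_⟶? t) perm) ⟨
      length (in′ t (s ∷ (E ++ X) ++ (S ++ Y)))
        ≡⟨ cong length (filter-accept (_⟶? t) (s⟶S t∈S)) ⟩
      suc (length (in′ t ((E ++ X) ++ (S ++ Y))))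
        ≡⟨ cong (λ i → suc (length i)) (filter-++ (_⟶? t) (E ++ X) (S ++ Y)) ⟩
      suc (length (in′ t (E ++ X) ++ in′ t (S ++ Y)))
        ≡⟨ cong suc (length-++ (in′ t (E ++ X))) ⟩
      suc (length (in′ t (E ++ X)) + length (in′ t (S ++ Y)))
        ≡⟨ cong₂ (λ i j → suc (length i + length j))
                 (filter-++ (_⟶? t) E X) (filter-++ (_⟶? t) S Y) ⟩
      suc (length (in′ t E ++ in′ t X) + length (in′ t S ++ in′ t Y))
        ≡⟨ cong₂ (λ i j → suc (length (i ++ in′ t X) + length (in′ t S ++ j)))
                 (filter-none (_⟶? t) (All.tabulate (asym ∘ S⇉E t∈S)))
                 (filter-none (_⟶? t) (All.tabulate (asym ∘ S⇉Y t∈S))) ⟩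
      suc (length (in′ t X) + length (in′ t S ++ []))
        ≡⟨ cong (λ i → suc (length (in′ t X) + length i)) (++-identityʳ (in′ t S)) ⟩
      suc (length (in′ t X) + length (in′ t S)) ∎
      where open ≡-Reasoning

    outRay-EY : ∃ λ v → v ∈ E ++ Y × Ray _⟶_ (t ⟶_) b v
    outRay-EY with Out.rédei uEY
    ... | []    , _ , p = contradiction (≤-trans 1≤b (≤-trans b≤EY (≤-reflexive (sym (↭-length p))))) λ ()
    ... | v ∷ q , l , p = v , ∈-resp-↭ p (here refl) , q , l , Unique-resp-↭ (↭-sym p) uEY ,
      ≤-trans b≤EY (≤-reflexive (sym (↭-length p))) ,
      All.tabulate (S⇉EY t∈S ∘ ∈-resp-↭ p)

    -- X ∩ N⁻(t), s, S ∩ N⁻(t) are traversed in this order before t, and E ∪ Y after it.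
    viaInnerInNeighbour : ∀ {u} → u ∈ in′ t S → a ≤ suc (length (in′ t X) + length (in′ t S)) →
                          Extension _⟶_ a b
    viaInnerInNeighbour u∈ a≤
      with In.rédei (Unique.filter⁺ (_⟶? t) uS) | In.rédei (Unique.filter⁺ (_⟶? t) uX)
    ... | []    , _ , p | _ = contradiction (∈-resp-↭ (↭-sym p) u∈) λ ()
    ... | u ∷ P , l , p | Q , k , q =
      t , u , proj₁ outRay-EY ,
      (P ++ s ∷ Q , In.linked-++∷ l (s⟶S ∘ inS) linked-sQ ,
       Unique.++⁺ (Unique-resp-↭ (↭-sym p) (Unique.filter⁺ (_⟶? t) uS)) unique-sQ disjoint ,
       ≤-trans a≤ (≤-reflexive length≡) ,
       All.++⁺ (All.tabulate x⟶t)
         (s⟶S t∈S ∷ All.tabulate (proj₂ ∘ ∈-filter⁻ (_⟶? t) {xs = X} ∘ ∈-resp-↭ q))) ,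
      proj₂ (proj₂ outRay-EY) , S⇉EY (inS (here refl)) (proj₁ (proj₂ outRay-EY))
      where
      inX : ∀ {x} → x ∈ Q → x ∈ X
      inX = proj₁ ∘ ∈-filter⁻ (_⟶? t) ∘ ∈-resp-↭ q
      inS : ∀ {x} → x ∈ u ∷ P → x ∈ S
      inS = proj₁ ∘ ∈-filter⁻ (_⟶? t) ∘ ∈-resp-↭ p
      x⟶t : ∀ {x} → x ∈ u ∷ P → x ⟶ t
      x⟶t = proj₂ ∘ ∈-filter⁻ (_⟶? t) {xs = S} ∘ ∈-resp-↭ p
      linked-sQ : Linked (flip _⟶_) (s ∷ Q)
      linked-sQ = In.linked-++ [-] k λ { (here refl) → X⟶s ∘ inX }
      unique-sQ : Unique (s ∷ Q)
      unique-sQ = Unique-∷⁺ (irrefl ∘ X⟶s ∘ inX)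
        (Unique-resp-↭ (↭-sym q) (Unique.filter⁺ (_⟶? t) uX))
      disjoint : ∀ {x} → ¬ (x ∈ u ∷ P × x ∈ s ∷ Q)
      disjoint (x∈P , here refl)  = irrefl (s⟶S (inS x∈P))
      disjoint (x∈P , there x∈Q) = asym (s⟶S (inS x∈P)) (X⟶s (inX x∈Q))
      length≡ : suc (length (in′ t X) + length (in′ t S)) ≡ length (u ∷ P ++ s ∷ Q)
      length≡ = begin
        suc (length (in′ t X) + length (in′ t S))
          ≡⟨ cong₂ (λ i j → suc (i + j)) (↭-length (↭-sym q)) (↭-length (↭-sym p)) ⟩
        suc (length Q + length (u ∷ P)) ≡⟨ +-comm (suc (length Q)) (length (u ∷ P)) ⟩
        length (u ∷ P) + length (s ∷ Q) ≡⟨ length-++ (u ∷ P) ⟨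
        length (u ∷ P ++ s ∷ Q)         ∎
        where open ≡-Reasoning

    module _ (X⟶t : ∀ {x} → x ∈ X → x ⟶ t) (a≤1+X : a ≤ suc (length X)) where

      -- The in-part is `X` followed by `s`; hence the out-part has to begin at an out-neighbour of
      -- `s`, that is, in `S` or `Y`.
      inRay-s : Ray (flip _⟶_) (_⟶ t) a s
      inRay-s with Q , k , q ← In.rédei uX =
        Q , In.linked-++ [-] k (λ { (here refl) → X⟶s ∘ ∈-resp-↭ q }) ,
        Unique-∷⁺ (irrefl ∘ X⟶s ∘ ∈-resp-↭ q) (Unique-resp-↭ (↭-sym q) uX) ,
        ≤-trans a≤1+X (s≤s (≤-reflexive (↭-length (↭-sym q)))) ,
        s⟶S t∈S ∷ All.tabulate (X⟶t ∘ ∈-resp-↭ q)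

      -- The vertices of `S` other than `t` are dominated by `s` and dominate `E ∪ Y`, so they lead
      -- the path from `s` into `E ∪ Y`.
      viaInnerOutNeighbours : ∀ {z Z} → S ↭ t ∷ z ∷ Z → (∀ {x} → x ∈ z ∷ Z → t ⟶ x) →
                              Extension _⟶_ a b
      viaInnerOutNeighbours {z} {Z} S↭ t⟶Z
        with Out.rédei (Unique-tail (Unique-resp-↭ S↭ uS)) | Out.rédei uEY
      ... | []    , _ , p | _ = contradiction (∈-resp-↭ (↭-sym p) (here refl)) λ ()
      ... | v ∷ P , l , p | Q , k , q = t , s , v , inRay-s ,
        (P ++ Q , Out.linked-++ l k (λ x∈ → S⇉EY (inS x∈) ∘ ∈-resp-↭ q) ,
         Unique.++⁺ (Unique-resp-↭ (↭-sym p) (Unique-tail (Unique-resp-↭ S↭ uS)))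
                    (Unique-resp-↭ (↭-sym q) uEY)
                    (λ (x∈P , x∈Q) → irrefl (S⇉EY (inS x∈P) (∈-resp-↭ q x∈Q))) ,
         ≤-trans b≤EY (≤-trans (≤-reflexive (↭-length (↭-sym q)))
           (≤-trans (m≤n+m (length Q) (length (v ∷ P))) (≤-reflexive (sym (length-++ (v ∷ P)))))) ,
         All.++⁺ (All.tabulate (t⟶Z ∘ ∈-resp-↭ p)) (All.tabulate (S⇉EY t∈S ∘ ∈-resp-↭ q))) ,
        s⟶S (inS (here refl))
        where
        inS : ∀ {x} → x ∈ v ∷ P → x ∈ S
        inS = ∈-resp-↭ (↭-sym S↭) ∘ there ∘ ∈-resp-↭ p

      -- A path through `Y` begins at an out-neighbour of `s` but is one vertex short of `b`. The
      -- arc from `y` lets `e` be inserted behind the head, which remains in `Y`.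
      viaBackArc : ∀ {y e} → y ∈ Y → e ∈ E → y ⟶ e → b ≤ suc (length Y) → Extension _⟶_ a b
      viaBackArc {y} {e} y∈Y e∈E y⟶e b≤1+Y with Out.rédei uY
      ... | []    , _ , p = contradiction (∈-resp-↭ (↭-sym p) y∈Y) λ ()
      ... | c ∷ C , l , p
        with D , k , q ← Out.insert l (lose (∈-resp-↭ (↭-sym p) y∈Y) y⟶e)
               (All.tabulate λ { c∈ refl → asym (E⟶s e∈E) (s⟶Y (∈-resp-↭ p c∈)) })
        with cD↭eY ← trans (prep c q) (trans (swap c e refl) (prep e p)) =
        t , s , c , inRay-s ,
        (D , k ,
         Unique-resp-↭ (↭-sym cD↭eY) (Unique-∷⁺ (asym (E⟶s e∈E) ∘ s⟶Y) uY) ,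
         ≤-trans b≤1+Y (≤-reflexive (↭-length (↭-sym cD↭eY))) ,
         All.tabulate (λ x∈ → t⟶eY (∈-resp-↭ cD↭eY x∈))) ,
        s⟶Y (∈-resp-↭ p (here refl))
        where
        t⟶eY : ∀ {x} → x ∈ e ∷ Y → t ⟶ x
        t⟶eY (here refl) = S⇉E t∈S e∈E
        t⟶eY (there x∈)  = S⇉Y t∈S x∈

      Z : List V
      Z = s ∷ t ∷ E
      uZ : Unique Z
      uZ = Unique-∷⁺ (λ { (here refl) → irrefl (s⟶S t∈S) ; (there s∈E) → irrefl (E⟶s s∈E) })
             (Unique-∷⁺ (λ t∈E → irrefl (S⇉E t∈S t∈E)) uE)
      X⇉Z : X ⇉ Z
      X⇉Z x∈ (here refl)         = X⟶s x∈
      X⇉Z x∈ (there (here refl)) = X⟶t x∈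
      X⇉Z x∈ (there (there e∈))  = X⇉E x∈ e∈

      Z⇉Y : E ⇉ Y → Z ⇉ Y
      Z⇉Y E⇉Y (here refl)         y∈ = s⟶Y y∈
      Z⇉Y E⇉Y (there (here refl)) y∈ = S⇉Y t∈S y∈
      Z⇉Y E⇉Y (there (there e∈))  y∈ = E⇉Y e∈ y∈

      -- E, s and t form a set Z of a + b + 1 ≥ 4 vertices with X ⇉ Z ⇉ Y. This is the only use of n ≥ 3.
      viaTransitiveTriple : E ⇉ Y → a + b ≤ suc (length E) → b ≤ suc (length Y) → Extension _⟶_ a b
      viaTransitiveTriple E⇉Y a+b≤1+E b≤1+Y
        with u , c , w , u∈ , c∈ , w∈ , u⟶c , c⟶w , u⟶w ←
               Degrees.transitiveTriple T uZ (s≤s (≤-trans 3≤a+b a+b≤1+E))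
           | P , l , p ← In.rédei uX | Q , k , q ← Out.rédei uY =
        c , u , w ,
        (P , In.linked-++ [-] l (λ { (here refl) x∈ → X⇉Z (∈-resp-↭ p x∈) u∈ }) ,
         Unique-∷⁺ (λ u∈P → irrefl (X⇉Z (∈-resp-↭ p u∈P) u∈)) (Unique-resp-↭ (↭-sym p) uX) ,
         ≤-trans a≤1+X (s≤s (≤-reflexive (↭-length (↭-sym p)))) ,
         u⟶c ∷ All.tabulate (λ x∈ → X⇉Z (∈-resp-↭ p x∈) c∈)) ,
        (Q , Out.linked-++ [-] k (λ { (here refl) y∈ → Z⇉Y E⇉Y w∈ (∈-resp-↭ q y∈) }) ,
         Unique-∷⁺ (λ w∈Q → irrefl (Z⇉Y E⇉Y w∈ (∈-resp-↭ q w∈Q))) (Unique-resp-↭ (↭-sym q) uY) ,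
         ≤-trans b≤1+Y (s≤s (≤-reflexive (↭-length (↭-sym q)))) ,
         c⟶w ∷ All.tabulate (λ y∈ → Z⇉Y E⇉Y c∈ (∈-resp-↭ q y∈))) ,
        u⟶w

      module _ (S↭ : S ↭ t ∷ []) where

        b≤1+Y : b ≤ suc (length Y)
        b≤1+Y = ≤-trans b≤SY (≤-reflexive (↭-length (++⁺ʳ Y S↭)))

        size′ : (length X + length Y + 2) + suc (length E) ≡ (a + b) + (a + b)
        size′ = begin
          (length X + length Y + 2) + suc (length E)
            ≡⟨ regroup (length X) (length Y) (length E) ⟩
          suc (suc ((length E + length X) + suc (length Y)))
            ≡⟨ cong₂ (λ i j → suc (suc (i + j))) (length-++ E) (↭-length (++⁺ʳ Y S↭)) ⟨
          suc (suc (length (E ++ X) + length (S ++ Y)))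
            ≡⟨ cong (2 +_) (length-++ (E ++ X)) ⟨
          suc (suc (length ((E ++ X) ++ (S ++ Y))))
            ≡⟨ cong suc (↭-length perm) ⟩
          suc (length L)
            ≡⟨ size ⟩
          (a + b) + (a + b) ∎
          where
          open ≡-Reasoning
          regroup : ∀ x y e → (x + y + 2) + suc e ≡ suc (suc ((e + x) + suc y))
          regroup = solve-∀

        -- `|X| + |Y|` is at most `a + b − 2`; with `s` and `t` this leaves at least `a + b − 1` of
        -- the `2(a + b) − 1` vertices for `E`.
        a+b≤1+E : a + b ≤ suc (length E)
        a+b≤1+E = +-cancelˡ-≤ (length X + length Y + 2) _ _ (begin
          (length X + length Y + 2) + (a + b)   ≡⟨ cong (_+ (a + b)) (regroup (length X) (length Y)) ⟩
          suc (length X) + suc (length Y) + (a + b) ≤⟨ +-monoˡ-≤ (a + b) (+-mono-≤ X<a Y<b) ⟩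
          (a + b) + (a + b)                     ≡⟨ size′ ⟨
          (length X + length Y + 2) + suc (length E) ∎)
          where
          open ≤-Reasoning
          regroup : ∀ x y → x + y + 2 ≡ suc x + suc y
          regroup = solve-∀

        singleton : Extension _⟶_ a b
        singleton with any? (λ y → any? (y ⟶?_) E) Y
        ... | yes any with y , y∈ , y⇝ ← find any with e , e∈ , y⟶e ← find y⇝ =
          viaBackArc y∈ e∈ y⟶e b≤1+Y
        ... | no ¬any = viaTransitiveTriple E⇉Y a+b≤1+E b≤1+Y
          where
          E⇉Y : E ⇉ Y
          E⇉Y e∈ y∈ with connex (λ { refl → asym (E⟶s e∈) (s⟶Y y∈) })
          ... | inj₁ e⟶y = e⟶y
          ... | inj₂ y⟶e = contradiction (lose y∈ (lose e∈ y⟶e)) ¬any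

    noInnerInNeighbour : in′ t S ≡ [] → a ≤ suc (length (in′ t X)) → Extension _⟶_ a b
    noInnerInNeighbour eq a≤ with ∈⇒↭ t∈S
    ... | S₀ , S↭ = byRest S₀ S↭
      where
      a≤1+X : a ≤ suc (length X)
      a≤1+X = ≤-trans a≤ (s≤s (length-filter (_⟶? t) X))
      -- `a − 1 ≤ |N⁻(t) ∩ X| ≤ |X| ≤ a − 1`, so the filter removes nothing.
      in-t-X≡X : in′ t X ≡ X
      in-t-X≡X = filter-complete (_⟶? t)
        (≤-antisym (length-filter (_⟶? t) X) (≤-pred (≤-trans X<a a≤)))
      X⟶t : ∀ {x} → x ∈ X → x ⟶ t
      X⟶t x∈ = proj₂ (∈-filter⁻ (_⟶? t) {xs = X} (subst (_ ∈_) (sym in-t-X≡X) x∈))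
      t⟶rest : ∀ {S₀ x} → S ↭ t ∷ S₀ → x ∈ S₀ → t ⟶ x
      t⟶rest S↭ x∈ with connex (λ { refl → Unique[x∷xs]⇒x∉xs (Unique-resp-↭ S↭ uS) x∈ })
      ... | inj₁ t⟶x = t⟶x
      ... | inj₂ x⟶t = contradiction
        (subst (_ ∈_) eq (∈-filter⁺ (_⟶? t) (∈-resp-↭ (↭-sym S↭) (there x∈)) x⟶t)) λ ()
      byRest : ∀ S₀ → S ↭ t ∷ S₀ → Extension _⟶_ a b
      byRest []      S↭ = singleton X⟶t a≤1+X S↭
      byRest (_ ∷ _) S↭ = viaInnerOutNeighbours X⟶t a≤1+X S↭ (t⟶rest S↭)

    starts-small : Extension _⟶_ a b ⊎ Small (T ᵒᵖ) L a t
    starts-small with length (in′ t L) <? a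
    ... | yes t< = inj₂ t<
    ... | no t≮ = inj₁ (byInner (in′ t S) refl)
      where
      a≤ : a ≤ suc (length (in′ t X) + length (in′ t S))
      a≤ = ≤-trans (≮⇒≥ t≮) (≤-reflexive in-t)
      byInner : ∀ I → in′ t S ≡ I → Extension _⟶_ a b
      byInner (u ∷ _) eq = viaInnerInNeighbour (subst (u ∈_) (sym eq) (here refl)) a≤
      byInner []      eq = noInnerInNeighbour eq (subst (a ≤_)
        (cong suc (≡-trans (cong (λ I → length (in′ t X) + length I) eq) (+-identityʳ _))) a≤)

-- Confined vertices and the final count.

small? : ∀ (T : Tournament V) L b v → Dec (Small T L b v)
small? T L b v = length (Tournament.out T v L) <? b

-- Vertices classified this way are put into the set `U` of the final count. Out-neighbours of
-- in-degree at least `a` are counted, instead of those in `U`, because `U` is known only once all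
-- vertices are classified.
Confined : (T : Tournament V) → List V → ℕ → ℕ → V → Set
Confined T L a b v =
  ¬ Small (T ᵒᵖ) L a v ×
  length (filter (λ x → ¬? (small? (T ᵒᵖ) L a x)) (Tournament.out T v L)) < b

-- Unless there is a copy, `Key` gives all of `S` in-degree below `a`, so the out-neighbours that
-- count lie in `Y`.
confine : ∀ (T : Tournament V) {L a b s X E S Y} → Blocked T L a b s X E S Y →
          b ≤ length E + length Y → S ++ Y ↭ Tournament.out T s L → ¬ Small (T ᵒᵖ) L a s →
          Extension (Tournament._⟶_ T) a b ⊎ Confined T L a b s
confine T {L} {a} {b} {s} {S = S} {Y} B b≤ SY↭ large with all⊎ S (Sum.swap ∘ Key.starts-small T B b≤)
... | inj₂ ext    = inj₁ ext
... | inj₁ smallS = inj₂ (large , (begin-strict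
  length (filter P? (Tournament.out T s L))     ≡⟨ ↭-length (filter-↭ P? SY↭) ⟨
  length (filter P? (S ++ Y))                   ≡⟨ cong length (filter-++ P? S Y) ⟩
  length (filter P? S ++ filter P? Y)
    ≡⟨ cong (λ Z → length (Z ++ filter P? Y))
            (filter-none P? (All.tabulate λ x∈ ¬small → ¬small (smallS x∈))) ⟩
  length (filter P? Y)                          ≤⟨ length-filter P? Y ⟩
  length Y                                      <⟨ Blocked.Y<b B ⟩
  b                                             ∎))
  where
  open ≤-Reasoning
  P? : ∀ x → Dec (¬ Small (T ᵒᵖ) L a x)
  P? x = ¬? (small? (T ᵒᵖ) L a x)

module Classification (T : Tournament V) {L : List V} {a b : ℕ} {s : V} (s∈L : s ∈ L) (uL : Unique L)
  (size : suc (length L) ≡ (a + b) + (a + b)) (3≤a+b : 3 ≤ a + b) (1≤a : 1 ≤ a) (1≤b : 1 ≤ b) where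
  open Tournament T

  out-in-s : s ∷ out s L ++ in′ s L ↭ L
  out-in-s with L₀ , p ← ∈⇒↭ s∈L =
    trans (prep s (trans (++⁺ (filter-s (s ⟶?_) irrefl) (filter-s (_⟶? s) irrefl))
      (Degrees.out-in T (Unique[x∷xs]⇒x∉xs (Unique-resp-↭ p uL))))) (↭-sym p)
    where
    filter-s : {P : Pred _ _} (P? : ∀ x → Dec (P x)) → ¬ P s → filter P? L ↭ filter P? L₀
    filter-s P? ¬Ps = trans (filter-↭ P? p) (↭-reflexive (filter-reject P? ¬Ps))

  degrees : suc (suc (length (out s L) + length (in′ s L))) ≡ (a + b) + (a + b)
  degrees = ≡-trans (cong (2 +_) (sym (length-++ (out s L))))
              (≡-trans (cong suc (↭-length out-in-s)) size)

  notBothSmall : Small (T ᵒᵖ) L a s → Small T L b s → ∀ {Q : Set} → Q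
  notBothSmall in<a out<b = contradiction (begin-strict
    a + b                               <⟨ m<m+n (a + b) (≤-trans 1≤a (m≤m+n a b)) ⟩
    (a + b) + (a + b)                   ≡⟨ degrees ⟨
    suc (suc (length (out s L) + length (in′ s L)))
      ≡⟨ cong suc (+-suc (length (out s L)) (length (in′ s L))) ⟨
    suc (length (out s L)) + suc (length (in′ s L)) ≤⟨ +-mono-≤ out<b in<a ⟩
    b + a                               ≡⟨ +-comm b a ⟩
    a + b                               ∎) (<-irrefl refl)
    where open ≤-Reasoning

  Result : Set
  Result = Confined (T ᵒᵖ) L b a s ⊎ Confined T L a b s ⊎ Extension _⟶_ a b

  blocked : ∀ {X E S Y} → E ++ X ↭ in′ s L → S ++ Y ↭ out s L → X ⇉ E → S ⇉ Y → S ⇉ E →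
            length X < a → length Y < b → ¬ Small (T ᵒᵖ) L a s → ¬ Small T L b s →
            Blocked T L a b s X E S Y
  blocked {X} {E} {S} {Y} EX↭ SY↭ X⇉E S⇉Y S⇉E X<a Y<b ¬in ¬out = record
    { perm = trans (prep s (trans (++-comm (E ++ X) (S ++ Y)) (++⁺ SY↭ EX↭))) out-in-s
    ; unique = uL ; size = size ; 3≤a+b = 3≤a+b ; 1≤a = 1≤a ; 1≤b = 1≤b
    ; before = proj₂ ∘ ∈-filter⁻ (_⟶? s) {xs = L} ∘ ∈-resp-↭ EX↭
    ; after  = proj₂ ∘ ∈-filter⁻ (s ⟶?_) {xs = L} ∘ ∈-resp-↭ SY↭
    ; X⇉E = X⇉E ; S⇉Y = S⇉Y ; S⇉E = S⇉E ; X<a = X<a ; Y<b = Y<b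
    ; a≤EX = ≤-trans (≮⇒≥ ¬in) (≤-reflexive (↭-length (↭-sym EX↭)))
    ; b≤SY = ≤-trans (≮⇒≥ ¬out) (≤-reflexive (↭-length (↭-sym SY↭)))
    }

  -- `|E| + |X| ≥ a` and `|S| + |Y| ≥ b` add up, so `|E| + |Y| < b` forces `|S| + |X| > a`: either
  -- `B` or its reversal meets the condition of `Key`.
  fromBlocked : ∀ {X E S Y} → E ++ X ↭ in′ s L → S ++ Y ↭ out s L → Blocked T L a b s X E S Y →
                ¬ Small (T ᵒᵖ) L a s → ¬ Small T L b s → Result
  fromBlocked {X} {E} {S} {Y} EX↭ SY↭ B ¬in ¬out with b ≤? length E + length Y
  ... | yes b≤ with confine T B b≤ SY↭ ¬in
  ...   | inj₁ ext = inj₂ (inj₂ ext)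
  ...   | inj₂ c   = inj₂ (inj₁ c)
  fromBlocked {X} {E} {S} {Y} EX↭ SY↭ B ¬in ¬out | no b≰
    with confine (T ᵒᵖ) (blocked-op B) a≤S+X EX↭ ¬out
    where
    open ≤-Reasoning
    regroup : ∀ x e t y → (e + x) + (t + y) ≡ (e + y) + (t + x)
    regroup = solve-∀
    a≤S+X : a ≤ length S + length X
    a≤S+X = +-cancelˡ-≤ (length E + length Y) _ _ (<⇒≤ (begin-strict
      (length E + length Y) + a   <⟨ +-monoˡ-< a (≰⇒> b≰) ⟩
      b + a                       ≡⟨ +-comm b a ⟩
      a + b                       ≤⟨ +-mono-≤ (Blocked.a≤EX B) (Blocked.b≤SY B) ⟩
      length (E ++ X) + length (S ++ Y) ≡⟨ cong₂ _+_ (length-++ E) (length-++ S) ⟩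
      (length E + length X) + (length S + length Y)
        ≡⟨ regroup (length X) (length E) (length S) (length Y) ⟩
      (length E + length Y) + (length S + length X) ∎))
  ... | inj₁ ext = inj₂ (inj₂ (Extension-op ext))
  ... | inj₂ c   = inj₁ c

  classify : Result
  classify with small? (T ᵒᵖ) L a s | small? T L b s
  ... | yes in<a | yes out<b = notBothSmall in<a out<b
  -- Having fewer than `a` in-neighbours in all, `s` is confined in `T ᵒᵖ` whatever their
  -- out-degrees.
  ... | yes in<a | no ¬out   = inj₁ (¬out , ≤-<-trans (length-filter _ (in′ s L)) in<a)
  ... | no ¬in   | yes out<b = inj₂ (inj₁ (¬in , ≤-<-trans (length-filter _ (out s L)) out<b))
  ... | no ¬in   | no ¬out
    with Paths.decompose T (out s L) 1≤b (Unique.filter⁺ (s ⟶?_) uL)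
       | Paths.decompose (T ᵒᵖ) (in′ s L) 1≤a (Unique.filter⁺ (_⟶? s) uL)
  ... | S , Y , SY↭ , S⇉Y , Y<b , outRay | E , X , EX↭ , X⇉E , X<a , inRay
    with any? (λ e → any? (e ⟶?_) S) E
  -- An arc from `E` to `S` joins the backward ray of its tail to the forward ray of its head: a
  -- copy centred at `s`.
  ...   | yes any with e , e∈ , e⇝ ← find any with v , v∈ , e⟶v ← find e⇝ =
    inj₂ (inj₂ (s , e , v ,
      Paths.ray-mono (T ᵒᵖ) (proj₂ ∘ ∈-filter⁻ (_⟶? s) {xs = L}) (inRay e∈) ,
      Paths.ray-mono T (proj₂ ∘ ∈-filter⁻ (s ⟶?_) {xs = L}) (outRay v∈) , e⟶v))
  ...   | no ¬any = fromBlocked EX↭ SY↭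
    (blocked EX↭ SY↭ (λ x∈ e∈ → X⇉E e∈ x∈) S⇉Y S⇉E X<a Y<b ¬in ¬out) ¬in ¬out
    where
    S⇉E : S ⇉ E
    S⇉E {t} {e} t∈ e∈ with connex {t} {e} (λ { refl →
      asym (proj₂ (∈-filter⁻ (s ⟶?_) {xs = L} (∈-resp-↭ SY↭ (∈-++⁺ˡ t∈))))
           (proj₂ (∈-filter⁻ (_⟶? s) {xs = L} (∈-resp-↭ EX↭ (∈-++⁺ˡ e∈)))) })
    ... | inj₁ t⟶e = t⟶e
    ... | inj₂ e⟶t = contradiction (lose e∈ (lose t∈ e⟶t)) ¬any

-- With `2b` vertices in `U`, some `v` would have `b` out-neighbours in `U`. Members of `U` have
-- in-degree at least `a`, so all of these count against the confinement of `v`.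
confined-few : ∀ (T : Tournament V) {L a b} U W → U ++ W ↭ L → Unique L → 1 ≤ b →
               All (Confined T L a b) U → ¬ b + b ≤ length U
confined-few T {L} {a} {b} U W UW↭ uL 1≤b conf 2b≤
  with v , v∈ , b≤ ← Degrees.largeOutdegree T 1≤b
         (Unique-++⁻ˡ U (Unique-resp-↭ (↭-sym UW↭) uL)) 2b≤
  = contradiction (proj₂ (All.lookup conf v∈)) (≤⇒≯ (begin
    b                                                  ≤⟨ b≤ ⟩
    length (out v U)                                   ≡⟨ cong length (filter-all P? outU) ⟨
    length (filter P? (out v U))                       ≤⟨ m≤m+n _ _ ⟩
    length (filter P? (out v U)) + length (filter P? (out v W))
      ≡⟨ length-++ (filter P? (out v U)) ⟨
    length (filter P? (out v U) ++ filter P? (out v W))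
      ≡⟨ cong length (filter-++ P? (out v U) (out v W)) ⟨
    length (filter P? (out v U ++ out v W))
      ≡⟨ cong (length ∘ filter P?) (filter-++ (v ⟶?_) U W) ⟨
    length (filter P? (out v (U ++ W)))
      ≡⟨ ↭-length (filter-↭ P? (filter-↭ (v ⟶?_) UW↭)) ⟩
    length (filter P? (out v L))                       ∎))
  where
  open Tournament T
  open ≤-Reasoning
  P? : ∀ x → Dec (¬ Small (T ᵒᵖ) L a x)
  P? x = ¬? (small? (T ᵒᵖ) L a x)
  outU : All (λ x → ¬ Small (T ᵒᵖ) L a x) (out v U)
  outU = All.tabulate (λ x∈ → proj₁ (All.lookup conf (proj₁ (∈-filter⁻ (v ⟶?_) x∈))))

extension : ∀ (T : Tournament V) {L a b} → Unique L → suc (length L) ≡ (a + b) + (a + b) →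
            3 ≤ a + b → 1 ≤ a → 1 ≤ b → Extension (Tournament._⟶_ T) a b
extension T {L} {a} {b} uL size 3≤a+b 1≤a 1≤b
  with all⊎ L (λ s∈ → Sum.assocˡ (Classification.classify T s∈ uL size 3≤a+b 1≤a 1≤b))
... | inj₂ ext = ext
... | inj₁ cls with W , U , WU↭ , confW , confU ← separate L cls
  with a + a ≤? length W | b + b ≤? length U
... | yes 2a≤ | _ = contradiction 2a≤ (confined-few (T ᵒᵖ) W U WU↭ uL 1≤a confW)
... | _ | yes 2b≤ = contradiction 2b≤ (confined-few T U W (trans (++-comm U W) WU↭) uL 1≤b confU)
... | no 2a≰ | no 2b≰ = contradiction (begin-strict
    suc (length L)              ≡⟨ cong suc (↭-length WU↭) ⟨
    suc (length (W ++ U))       ≡⟨ cong suc (length-++ W) ⟩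
    suc (length W) + length U   <⟨ +-mono-≤-< (≰⇒> 2a≰) (≰⇒> 2b≰) ⟩
    (a + a) + (b + b)           ≡⟨ regroup a b ⟩
    (a + b) + (a + b)           ≡⟨ size ⟨
    suc (length L)              ∎) (<-irrefl refl)
  where
  open ≤-Reasoning
  regroup : ∀ a b → (a + a) + (b + b) ≡ (a + b) + (a + b)
  regroup = solve-∀

-- From lists of vertices to copies of `Ext o`.

linked-take : ∀ {R : A → A → Set} n {xs} → Linked R xs → Linked R (take n xs)
linked-take zero          _         = []
linked-take (suc n)       []        = []
linked-take (suc n)       [-]       = subst (λ ys → Linked _ (_ ∷ ys)) (sym (take-[] n)) [-]
linked-take (suc zero)    (_ ∷ _)   = [-]
linked-take (suc (suc n)) (r ∷ l)   = r ∷ linked-take (suc n) l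

linked-ʳ++ : ∀ {R : A → A → Set} {u p v q} → Linked (flip R) (u ∷ p) → R u v → Linked R (v ∷ q) →
             Linked R ((u ∷ p) ʳ++ (v ∷ q))
linked-ʳ++ [-]     r l = r ∷ l
linked-ʳ++ (k ∷ p) r l = linked-ʳ++ p k (r ∷ l)

linked-lookup : ∀ {R : A → A → Set} {L} → Linked R L → ∀ i j → toℕ j ≡ suc (toℕ i) →
                R (lookup L i) (lookup L j)
linked-lookup {L = _ ∷ _ ∷ _} (r ∷ _) zero    (suc zero) _ = r
linked-lookup {L = _ ∷ _ ∷ _} (_ ∷ l) (suc i) (suc j)    e = linked-lookup l i j (cong pred e)

unique-lookup : ∀ {L : List A} → Unique L → ∀ i j → lookup L i ≡ lookup L j → i ≡ j
unique-lookup {L = _ ∷ _} u       zero    zero    _ = refl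
unique-lookup {L = _ ∷ _} u       zero    (suc j) e =
  contradiction (subst (_∈ _) (sym e) (∈-lookup j)) (Unique[x∷xs]⇒x∉xs u)
unique-lookup {L = _ ∷ _} u       (suc i) zero    e =
  contradiction (subst (_∈ _) e (∈-lookup i)) (Unique[x∷xs]⇒x∉xs u)
unique-lookup {L = _ ∷ _} (_ ∷ u) (suc i) (suc j) e = cong suc (unique-lookup u i j e)

lookup-++ : ∀ (I O : List A) (i : Fin (length (I ++ O))) →
            (toℕ i < length I × lookup (I ++ O) i ∈ I) ⊎ (length I ≤ toℕ i × lookup (I ++ O) i ∈ O)
lookup-++ []      O i       = inj₂ (z≤n , ∈-lookup i)
lookup-++ (x ∷ I) O zero    = inj₁ (s≤s z≤n , here refl)
lookup-++ (x ∷ I) O (suc i) =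
  Sum.map (λ (lt , x∈) → s≤s lt , there x∈) (λ (le , x∈) → s≤s le , x∈) (lookup-++ I O i)

fromDigraph : ∀ {p} (D : Digraph p) → IsTournament D → Tournament (Fin p)
fromDigraph D (irreflexive , total , antisymmetric) = record
  { _⟶_ = Arc D ; _⟶?_ = λ u v → D u v Bool.≟ true
  ; asym = antisymmetric _ _ ; connex = total _ _ }

-- The shape that acyclicity forces on `o`, where `k` counts the in-neighbours of `s`.
record Threshold (o : Fin n → Bool) (k : ℕ) : Set where
  field
    below : ∀ i → toℕ i < k → o i ≡ false
    above : ∀ i → k ≤ toℕ i → o i ≡ true

succ?⇒≡ : ∀ (i j : Fin n) → succ? i j ≡ true → toℕ j ≡ suc (toℕ i)
succ?⇒≡ i j eq with toℕ j ≟ suc (toℕ i)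
... | yes e = e

≡⇒succ? : ∀ (i j : Fin n) → toℕ j ≡ suc (toℕ i) → succ? i j ≡ true
≡⇒succ? i j e with toℕ j ≟ suc (toℕ i)
... | yes _ = refl
... | no ≢  = contradiction e ≢

-- Injectivity comes from `s`: an in-neighbour of `s` is neither `s` nor an out-neighbour, so `I`
-- and `O` avoid `s` and each other.
embed : ∀ {p} {D : Digraph p} → IsTournament D → ∀ {o : Fin n → Bool} {s} I O →
        Threshold o (length I) → length (I ++ O) ≡ n → Linked (Arc D) (I ++ O) →
        Unique I → Unique O → (∀ {x} → x ∈ I → Arc D x s) → (∀ {x} → x ∈ O → Arc D s x) →
        Ext o ⊑ D
embed {D = D} isT {o} {s} I O t refl l uI uO I⟶s s⟶O = f , injective , preserves
  where
  open Threshold t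
  open Tournament (fromDigraph D isT) using (asym; irrefl)
  L = I ++ O

  uL : Unique L
  uL = Unique.++⁺ uI uO λ (x∈I , x∈O) → asym (I⟶s x∈I) (s⟶O x∈O)

  s∉L : ¬ s ∈ L
  s∉L s∈ with ∈-++⁻ I s∈
  ... | inj₁ s∈I = irrefl (I⟶s s∈I)
  ... | inj₂ s∈O = irrefl (s⟶O s∈O)

  f : Fin (suc (length L)) → Fin _
  f zero    = s
  f (suc i) = lookup L i

  injective : Injective _≡_ _≡_ f
  injective {zero}  {zero}  _ = refl
  injective {zero}  {suc j} e = contradiction (subst (_∈ L) (sym e) (∈-lookup j)) s∉L
  injective {suc i} {zero}  e = contradiction (subst (_∈ L) e (∈-lookup i)) s∉L
  injective {suc i} {suc j} e = cong suc (unique-lookup uL i j e)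

  preserves : ∀ u v → Arc (Ext o) u v → Arc D (f u) (f v)
  preserves zero    zero    ()
  preserves zero    (suc j) oj with lookup-++ I O j
  ... | inj₂ (_ , j∈O) = s⟶O j∈O
  ... | inj₁ (j<k , _) = contradiction (≡-trans (sym oj) (below j j<k)) λ ()
  preserves (suc i) zero    ¬oi with lookup-++ I O i
  ... | inj₁ (_ , i∈I) = I⟶s i∈I
  ... | inj₂ (k≤i , _) = contradiction (≡-trans (sym ¬oi) (cong not (above i k≤i))) λ ()
  preserves (suc i) (suc j) i→j = linked-lookup l i j (succ?⇒≡ i j i→j)

embedExtension : ∀ {p} {D : Digraph p} → IsTournament D → ∀ {a b} {o : Fin (suc a + suc b) → Bool} →
                 Threshold o (suc a) → Extension (Arc D) (suc a) (suc b) → Ext o ⊑ D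
embedExtension {D = D} isT {a} {b} {o} t
  (s , u , v , (p , linkedP , uniqueP , s≤s a≤ , toS) , (q , linkedQ , uniqueQ , s≤s b≤ , fromS) , u⟶v)
  = embed isT (reverse I) O (subst (Threshold o) (sym lengthI) t)
      (≡-trans (length-++ (reverse I)) (cong₂ _+_ lengthI lengthO))
      (subst (Linked _) (ʳ++-defn I)
        (linked-ʳ++ (linked-take (suc a) linkedP) u⟶v (linked-take (suc b) linkedQ)))
      (Unique-resp-↭ (↭-sym (↭-reverse I)) (Unique.take⁺ (suc a) uniqueP))
      (Unique.take⁺ (suc b) uniqueQ)
      (All.lookup (All.take⁺ (suc a) toS) ∘ ∈-resp-↭ (↭-reverse I))
      (All.lookup (All.take⁺ (suc b) fromS))
  where
  -- Both cuts are made at the far ends, so `u`, `v` and the arc joining them survive.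
  I = take (suc a) (u ∷ p)
  O = take (suc b) (v ∷ q)
  lengthI : length (reverse I) ≡ suc a
  lengthI = ≡-trans (length-reverse I) (≡-trans (length-take (suc a) (u ∷ p)) (m≤n⇒m⊓n≡m (s≤s a≤)))
  lengthO : length O ≡ suc b
  lengthO = ≡-trans (length-take (suc b) (v ∷ q)) (m≤n⇒m⊓n≡m (s≤s b≤))

-- Upper bounds.

pathOfLength : ∀ (T : Tournament V) {H} → Unique H → n ≤ length H →
               ∃ λ P → length P ≡ n × Linked (Tournament._⟶_ T) P × Unique P ×
                       (∀ {x} → x ∈ P → x ∈ H)
pathOfLength {n = n} T uH n≤ with P , l , p ← Paths.rédei T uH =
  take n P ,
  ≡-trans (length-take n P) (m≤n⇒m⊓n≡m (subst (n ≤_) (↭-length (↭-sym p)) n≤)) ,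
  linked-take n l , Unique.take⁺ n (Unique-resp-↭ (↭-sym p) uH) ,
  ∈-resp-↭ p ∘ take⊆ n P
  where
  take⊆ : ∀ n (P : List _) {x} → x ∈ take n P → x ∈ P
  take⊆ (suc n) (_ ∷ P) (here e)   = here e
  take⊆ (suc n) (_ ∷ P) (there x∈) = there (take⊆ n P x∈)

unavoidable-source : ∀ {o : Fin n → Bool} → 1 ≤ n → Threshold o 0 → Unavoidable (Ext o) (n + n)
unavoidable-source {n} 1≤n t D isT
  with s , _ , n≤ ← Degrees.largeOutdegree (fromDigraph D isT) 1≤n (Unique.allFin⁺ (n + n))
                      (≤-reflexive (sym (length-tabulate id)))
  with P , len , l , u , P⊆ ← pathOfLength (fromDigraph D isT)
         (Unique.filter⁺ (Tournament._⟶?_ (fromDigraph D isT) s) (Unique.allFin⁺ (n + n))) n≤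
  = embed isT [] P t len l [] u (λ ())
      (proj₂ ∘ ∈-filter⁻ (Tournament._⟶?_ (fromDigraph D isT) s) {xs = allFin (n + n)} ∘ P⊆)

unavoidable-sink : ∀ {o : Fin n → Bool} → 1 ≤ n → Threshold o n → Unavoidable (Ext o) (n + n)
unavoidable-sink {n} {o} 1≤n t D isT
  with s , _ , n≤ ← Degrees.largeOutdegree (fromDigraph D isT ᵒᵖ) 1≤n (Unique.allFin⁺ (n + n))
                      (≤-reflexive (sym (length-tabulate id)))
  with P , len , l , u , P⊆ ← pathOfLength (fromDigraph D isT)
         (Unique.filter⁺ (Tournament._⟶?_ (fromDigraph D isT ᵒᵖ) s) (Unique.allFin⁺ (n + n))) n≤
  = embed isT P [] (subst (Threshold o) (sym len) t) (≡-trans (cong length (++-identityʳ P)) len)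
      (subst (Linked _) (sym (++-identityʳ P)) l) u []
      (proj₂ ∘ ∈-filter⁻ (Tournament._⟶?_ (fromDigraph D isT ᵒᵖ) s) {xs = allFin (n + n)} ∘ P⊆)
      (λ ())

unavoidable-mixed : ∀ {a b p} {o : Fin (suc a + suc b) → Bool} → Threshold o (suc a) →
                    3 ≤ suc a + suc b → suc p ≡ (suc a + suc b) + (suc a + suc b) →
                    Unavoidable (Ext o) p
unavoidable-mixed {a} {b} {p} t 3≤ size D isT =
  embedExtension isT t (extension (fromDigraph D isT) (Unique.allFin⁺ p)
    (≡-trans (cong suc (length-tabulate id)) size) 3≤ (s≤s z≤n) (s≤s z≤n))

-- Regular tournaments and the lower bounds.

even : ℕ → Bool
even zero          = true
even (suc zero)    = false
even (suc (suc n)) = even n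

-- For x < y the arc x → y is present iff y ∸ x is odd; restricted to the first 2m + 1
-- numbers this is a regular tournament.
parity : ℕ → ℕ → Bool
parity zero    zero    = false
parity zero    (suc y) = even y
parity (suc x) zero    = not (even x)
parity (suc x) (suc y) = parity x y

-- Enumerates the out-neighbours of x without gaps.
rank : ℕ → ℕ → ℕ
rank zero          zero          = zero
rank zero          (suc zero)    = zero
rank zero          (suc (suc y)) = suc (rank zero y)
rank (suc zero)    zero          = zero
rank (suc zero)    (suc y)       = rank zero y
rank (suc (suc x)) zero          = zero
rank (suc (suc x)) (suc zero)    = zero
rank (suc (suc x)) (suc (suc y)) = suc (rank x y)

-- Ranks go up by one for every two vertices, so the `2m + 1` numbers up to `2m` leave room for only
-- `m` of them.
rank-< : ∀ m x y → parity x y ≡ true → x ≤ m * 2 → y ≤ m * 2 → rank x y < m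
rank-< zero    zero          zero                ()
rank-< (suc m) zero          (suc zero)          _ _ _ = s≤s z≤n
rank-< (suc m) zero          (suc (suc (suc y))) x→y _ (s≤s (s≤s y≤)) =
  s≤s (rank-< m zero (suc y) x→y z≤n y≤)
rank-< m       (suc zero)    (suc y)             x→y _ y≤ = rank-< m zero y x→y z≤n (≤-trans (n≤1+n y) y≤)
rank-< (suc m) (suc (suc x)) zero                _ _ _ = s≤s z≤n
rank-< (suc m) (suc (suc x)) (suc zero)          _ _ _ = s≤s z≤n
rank-< (suc m) (suc (suc x)) (suc (suc y))       x→y (s≤s (s≤s x≤)) (s≤s (s≤s y≤)) =
  s≤s (rank-< m x y x→y x≤ y≤)

even-suc : ∀ n → even (suc n) ≡ not (even n)
even-suc zero          = refl
even-suc (suc zero)    = refl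
even-suc (suc (suc n)) = even-suc n

rank-injective : ∀ x y z → parity x y ≡ true → parity x z ≡ true → rank x y ≡ rank x z → y ≡ z
rank-injective zero (suc zero) (suc zero) _ _ _ = refl
rank-injective zero (suc (suc (suc y))) (suc (suc (suc z))) p q e =
  cong (2 +_) (rank-injective zero (suc y) (suc z) p q (cong pred e))
rank-injective (suc zero) (suc y) (suc z) p q e = cong suc (rank-injective zero y z p q e)
rank-injective (suc (suc x)) zero       zero       _ _ _ = refl
rank-injective (suc (suc x)) (suc zero) (suc zero) _ _ _ = refl
-- 0 and 1 share rank 0, but they are of opposite parity, so only one of them is an out-neighbour of
-- `x + 2`.
rank-injective (suc (suc x)) zero       (suc zero) p q _ with even x | even (suc x) | even-suc x
... | true  | .false | refl = contradiction q λ ()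
... | false | .true  | refl = contradiction p λ ()
rank-injective (suc (suc x)) (suc zero) zero       p q _ with even x | even (suc x) | even-suc x
... | true  | .false | refl = contradiction p λ ()
... | false | .true  | refl = contradiction q λ ()
rank-injective (suc (suc x)) (suc (suc y)) (suc (suc z)) p q e =
  cong (2 +_) (rank-injective x y z p q (cong pred e))

-- Pigeonhole: `rank` would map `m + 1` distinct out-neighbours injectively into `Fin m`.
parity-outdegree : ∀ {m x} (f : Fin (suc m) → ℕ) → (∀ {i j} → f i ≡ f j → i ≡ j) →
                   (∀ i → parity x (f i) ≡ true) → x ≤ m * 2 → ¬ (∀ i → f i ≤ m * 2)
parity-outdegree {m} {x} f f-injective x→f x≤ f≤ = <-irrefl refl (injective⇒≤ g-injective)
  where
  f< : ∀ i → rank x (f i) < m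
  f< i = rank-< m x (f i) (x→f i) x≤ (f≤ i)
  g-injective : Injective _≡_ _≡_ (λ i → fromℕ< (f< i))
  g-injective {i} {j} e = f-injective (rank-injective x (f i) (f j) (x→f i) (x→f j)
    (fromℕ<-injective _ _ (f< i) (f< j) e))

parity-irrefl : ∀ x → parity x x ≡ false
parity-irrefl zero    = refl
parity-irrefl (suc x) = parity-irrefl x

parity-flip : ∀ x y → x ≢ y → parity x y ≡ not (parity y x)
parity-flip zero    zero    ≢ = contradiction refl ≢
parity-flip zero    (suc y) _ = sym (not-involutive (even y))
parity-flip (suc x) zero    _ = refl
parity-flip (suc x) (suc y) ≢ = parity-flip x y (≢ ∘ cong suc)

-- The reversed parity tournament on [0, c), dominating the parity tournament on [c, ∞).
blocks : ℕ → ℕ → ℕ → Bool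
blocks c x y with x <? c | y <? c
... | yes _ | yes _ = parity y x
... | yes _ | no _  = true
... | no _  | yes _ = false
... | no _  | no _  = parity (x ∸ c) (y ∸ c)

blocks-irrefl : ∀ c x → blocks c x x ≡ false
blocks-irrefl c x with x <? c
... | yes _ = parity-irrefl x
... | no _  = parity-irrefl (x ∸ c)

blocks-flip : ∀ c x y → x ≢ y → blocks c x y ≡ not (blocks c y x)
blocks-flip c x y ≢ with x <? c | y <? c
... | yes _  | yes _  = parity-flip y x (≢-sym ≢)
... | yes _  | no _   = refl
... | no _   | yes _  = refl
... | no x≮c | no y≮c = parity-flip (x ∸ c) (y ∸ c) (≢ ∘ ∸-cancelʳ-≡ (≮⇒≥ x≮c) (≮⇒≥ y≮c))

blocksOn : ℕ → ∀ q → Digraph q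
blocksOn c q u v = blocks c (toℕ u) (toℕ v)

blocksOn-tournament : ∀ c q → IsTournament (blocksOn c q)
blocksOn-tournament c q = irreflexive , total , antisymmetric
  where
  B = blocksOn c q
  irreflexive : ∀ u → ¬ Arc B u u
  irreflexive u e = contradiction (≡-trans (sym e) (blocks-irrefl c (toℕ u))) λ ()
  total : ∀ u v → u ≢ v → Arc B u v ⊎ Arc B v u
  total u v ≢ with B u v in uv | B v u in vu
  ... | true  | _    = inj₁ refl
  ... | false | true = inj₂ refl
  ... | false | false = contradiction (≡-trans (sym uv)
    (≡-trans (blocks-flip c (toℕ u) (toℕ v) (≢ ∘ toℕ-injective)) (cong not vu))) λ ()
  antisymmetric : ∀ u v → Arc B u v → ¬ Arc B v u
  antisymmetric u v uv vu = contradiction (≡-trans (sym uv)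
    (≡-trans (blocks-flip c (toℕ u) (toℕ v)
                (λ e → irreflexive u (subst (Arc B u) (sym (toℕ-injective e)) uv)))
             (cong not vu))) λ ()

-- As the first block is reversed, its in-neighbours are out-neighbours for `parity`; so
-- `parity-outdegree` bounds the in-degrees there and the out-degrees in the second block.
blocks-in : ∀ {c x y} → x < c → blocks c y x ≡ true → y < c × parity x y ≡ true
blocks-in {c} {x} {y} x<c e with y <? c | x <? c
... | yes y<c | yes _  = y<c , e
... | no _    | yes _  = contradiction e λ ()
... | _       | no x≮c = contradiction x<c x≮c

blocks-out : ∀ {c x y} → c ≤ x → blocks c x y ≡ true → c ≤ y × parity (x ∸ c) (y ∸ c) ≡ true
blocks-out {c} {x} {y} c≤x e with x <? c | y <? c
... | no _    | no y≮c = ≮⇒≥ y≮c , e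
... | yes x<c | _      = contradiction c≤x (<⇒≱ x<c)

-- If `s` falls in the first block, its `k` in-neighbours lie there too, but in-degrees within a
-- block of at most `2k − 1` vertices stay below `k`; the second block is dual, with `l`. The bounds
-- are asked of nonempty blocks, so that `k` or `l` may be zero.
avoidable : ∀ {k l c q} {o : Fin (k + l) → Bool} → Threshold o k →
            (0 < c → ∃ λ m → k ≡ suc m × c ≤ suc (m * 2)) →
            (c < q → ∃ λ m → l ≡ suc m × q ≤ c + suc (m * 2)) →
            ¬ Unavoidable (Ext o) q
avoidable {k} {l} {c} {q} {o} t left right unavoidable
  with f , f-injective , preserves ← unavoidable (blocksOn c q) (blocksOn-tournament c q)
  with toℕ (f zero) <? c
... | yes s<c with m , refl , c≤ ← left (≤-trans (s≤s z≤n) s<c) =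
  parity-outdegree g g-injective (proj₂ ∘ arc) (≤-pred (≤-trans s<c c≤))
    (λ i → ≤-pred (≤-trans (proj₁ (arc i)) c≤))
  where
  g : Fin (suc m) → ℕ
  g i = toℕ (f (suc (i ↑ˡ l)))
  g-injective : ∀ {i j} → g i ≡ g j → i ≡ j
  g-injective e = ↑ˡ-injective l _ _ (Fin.suc-injective (f-injective (toℕ-injective e)))
  arc : ∀ i → g i < c × parity (toℕ (f zero)) (g i) ≡ true
  arc i = blocks-in s<c (preserves (suc (i ↑ˡ l)) zero (cong not
    (Threshold.below t (i ↑ˡ l) (subst (_< suc m) (sym (toℕ-↑ˡ i l)) (toℕ<n i)))))
... | no s≮c with m , refl , q≤ ← right (≤-<-trans (≮⇒≥ s≮c) (toℕ<n (f zero))) =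
  parity-outdegree (λ i → g i ∸ c) g∸c-injective (proj₂ ∘ arc)
    (bound (f zero)) (λ i → bound (f (suc (k ↑ʳ i))))
  where
  g : Fin (suc m) → ℕ
  g i = toℕ (f (suc (k ↑ʳ i)))
  arc : ∀ i → c ≤ g i × parity (toℕ (f zero) ∸ c) (g i ∸ c) ≡ true
  arc i = blocks-out (≮⇒≥ s≮c) (preserves zero (suc (k ↑ʳ i))
    (Threshold.above t (k ↑ʳ i) (subst (k ≤_) (sym (toℕ-↑ʳ k i)) (m≤m+n k (toℕ i)))))
  g∸c-injective : ∀ {i j} → g i ∸ c ≡ g j ∸ c → i ≡ j
  g∸c-injective {i} {j} e = ↑ʳ-injective k _ _ (Fin.suc-injective (f-injective (toℕ-injective
    (∸-cancelʳ-≡ (proj₁ (arc i)) (proj₁ (arc j)) e))))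
  bound : ∀ x → toℕ x ∸ c ≤ m * 2
  bound x = ≤-trans
    (∸-monoˡ-≤ c (≤-pred (≤-trans (toℕ<n x) (≤-trans q≤ (≤-reflexive (+-suc c (m * 2)))))))
    (≤-reflexive (m+n∸m≡n c (m * 2)))

-- The values for a source, a sink and a mixed extension.

isUnv-source : ∀ {o : Fin n → Bool} → 1 ≤ n → Threshold o 0 → IsUnv (Ext o) (n + n)
isUnv-source {suc m} 1≤n t = unavoidable-source 1≤n t , λ q q< →
  avoidable {k = 0} {c = 0} t (λ ())
    (λ _ → m , refl , ≤-trans (≤-pred q<) (≤-reflexive (double m)))
  where
  double : ∀ m → m + suc m ≡ suc (m * 2)
  double = solve-∀

isUnv-sink : ∀ {k} {o : Fin (k + 0) → Bool} → 1 ≤ k → Threshold o k → IsUnv (Ext o) (k + 0 + (k + 0))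
isUnv-sink {k@(suc m)} {o} 1≤k t =
  unavoidable-sink (≤-trans 1≤k (m≤m+n k 0)) (subst (Threshold o) (sym (+-identityʳ k)) t) , λ q q< →
  -- The first block has room for all `q ≤ 2k − 1` vertices, so the second is empty.
  avoidable {c = suc (m * 2)} t (λ _ → m , refl , ≤-refl)
    (λ c<q → contradiction (≤-trans (≤-pred q<) (≤-reflexive (double m))) (<⇒≱ c<q))
  where
  double : ∀ m → m + 0 + suc (m + 0) ≡ suc (m * 2)
  double = solve-∀

isUnv-mixed : ∀ {a b p} {o : Fin (suc a + suc b) → Bool} → Threshold o (suc a) →
              3 ≤ suc a + suc b → suc p ≡ (suc a + suc b) + (suc a + suc b) → IsUnv (Ext o) p
isUnv-mixed {a} {b} {p} t 3≤ size = unavoidable-mixed t 3≤ size , λ q q<p →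
  -- Blocks of `2a + 1` and `2b + 1` vertices have `p − 1` vertices together.
  avoidable {c = suc (a * 2)} t (λ _ → a , refl , ≤-refl)
    (λ _ → b , refl , ≤-pred (≤-pred (≤-trans (s≤s q<p) (≤-reflexive (≡-trans size (double a b))))))
  where
  double : ∀ a b → (suc a + suc b) + (suc a + suc b) ≡ suc (suc (suc (a * 2) + suc (b * 2)))
  double = solve-∀

-- Invariance under isomorphism, and `TT3`.

⊑-trans : ∀ {m k l} {D : Digraph m} {E : Digraph k} {F : Digraph l} → D ⊑ E → E ⊑ F → D ⊑ F
⊑-trans (f , f-inj , f-arc) (g , g-inj , g-arc) =
  g ∘ f , f-inj ∘ g-inj , λ u v → g-arc (f u) (f v) ∘ f-arc u v

IsUnv-resp-⊑ : ∀ {m k p} {D : Digraph m} {E : Digraph k} → D ⊑ E → E ⊑ D → IsUnv E p → IsUnv D p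
IsUnv-resp-⊑ {D = D} {E} D⊑E E⊑D (unavoidable , least) =
  (λ T isT → ⊑-trans {D = D} {E} {T} D⊑E (unavoidable T isT)) ,
  (λ q q<p D-unavoidable → least q q<p λ T isT → ⊑-trans {D = E} {D} {T} E⊑D (D-unavoidable T isT))

≅⇒⊑ : ∀ {m k} {D : Digraph m} {E : Digraph k} → D ≅ E → D ⊑ E × E ⊑ D
≅⇒⊑ {D = D} {E} (f , g , gf , fg , preserves , reflects) =
  (f , (λ {x} {y} e → ≡-trans (sym (gf x)) (≡-trans (cong g e) (gf y))) , preserves) ,
  (g , (λ {x} {y} e → ≡-trans (sym (fg x)) (≡-trans (cong f e) (fg y))) ,
    λ u v u→v → reflects (g u) (g v) (subst₂ (Arc E) (sym (fg u)) (sym (fg v)) u→v))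

-- `TT3` is also the extension of the path on two vertices by a source, which gives `2n = 4`.
isUnv-TT3 : IsUnv TT3 4
isUnv-TT3 = IsUnv-resp-⊑ {D = TT3} {E = source} (id , id , to) (id , id , from)
  (isUnv-source (s≤s z≤n) record { below = λ _ () ; above = λ _ _ → refl })
  where
  source : Digraph 3
  source = Ext {2} (λ _ → true)
  to : ∀ u v → Arc TT3 u v → Arc source u v
  to zero             (suc _)          _ = refl
  to (suc zero)       (suc (suc zero)) _ = refl
  from : ∀ u v → Arc source u v → Arc TT3 u v
  from zero             (suc _)          _ = refl
  from (suc zero)       (suc (suc zero)) _ = refl
  from (suc (suc zero)) (suc zero)       ()
  from (suc zero)       (suc zero)       ()
  from (suc (suc zero)) (suc (suc zero)) ()

TT3-isUnv : ∀ {o : Fin n → Bool} → Ext o ≅ TT3 → IsUnv (Ext o) (2 * suc n ∸ 2)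
TT3-isUnv {n} {o} iso with D⊑TT3 , TT3⊑D ← ≅⇒⊑ {D = Ext o} {TT3} iso
  -- Containment both ways forces `n = 2`, so `2 * suc n ∸ 2` computes to 4.
  with refl ← ≤-antisym (injective⇒≤ (proj₁ (proj₂ D⊑TT3))) (injective⇒≤ (proj₁ (proj₂ TT3⊑D)))
  = IsUnv-resp-⊑ {D = Ext o} {TT3} D⊑TT3 TT3⊑D isUnv-TT3

-- With one path vertex on either side, `s` is the middle vertex of `TT3`; hence `σ` exchanges the
-- first two vertices.
≅-TT3 : ∀ {o : Fin 2 → Bool} → Threshold o 1 → Ext o ≅ TT3
≅-TT3 {o} t = σ , σ , σσ , σσ , to , from
  where
  o₀ = Threshold.below t zero (s≤s z≤n)
  o₁ = Threshold.above t (suc zero) (s≤s z≤n)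
  σ : Fin 3 → Fin 3
  σ zero             = suc zero
  σ (suc zero)       = zero
  σ (suc (suc zero)) = suc (suc zero)
  σσ : ∀ x → σ (σ x) ≡ x
  σσ zero             = refl
  σσ (suc zero)       = refl
  σσ (suc (suc zero)) = refl
  to : ∀ u v → Arc (Ext o) u v → Arc TT3 (σ u) (σ v)
  to zero             (suc zero)       e = contradiction (≡-trans (sym e) o₀) λ ()
  to zero             (suc (suc zero)) _ = refl
  to (suc zero)       zero             _ = refl
  to (suc zero)       (suc (suc zero)) _ = refl
  to (suc (suc zero)) zero             e = contradiction (≡-trans (sym e) (cong not o₁)) λ ()
  to (suc (suc zero)) (suc zero)       ()
  to (suc (suc zero)) (suc (suc zero)) ()
  from : ∀ u v → Arc TT3 (σ u) (σ v) → Arc (Ext o) u v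
  from zero             (suc (suc zero)) _ = o₁
  from (suc zero)       zero             _ = cong not o₀
  from (suc zero)       (suc (suc zero)) _ = refl
  from zero             zero             ()
  from zero             (suc zero)       ()
  from (suc zero)       (suc zero)       ()
  from (suc (suc zero)) zero             ()
  from (suc (suc zero)) (suc zero)       ()
  from (suc (suc zero)) (suc (suc zero)) ()

-- Acyclicity and thresholds.

walkToAdded : ∀ {o : Fin n → Bool} d i j → toℕ i + d ≡ toℕ j → o j ≡ false →
             ∃ λ k → Walk (Ext o) (suc i) zero k
walkToAdded {o = o} zero i j e oj =
  1 , step (subst (λ i → Arc (Ext o) (suc i) zero)
        (toℕ-injective (≡-trans (sym e) (+-identityʳ (toℕ i)))) (cong not oj)) here
walkToAdded {n} {o = o} (suc d) i j e oj
  = suc (proj₁ rest) , step (≡⇒succ? i i′ toℕ-i′) (proj₂ rest)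
  where
  e′ : suc (toℕ i) + d ≡ toℕ j
  e′ = ≡-trans (sym (+-suc (toℕ i) d)) e
  i<n : suc (toℕ i) < n
  i<n = ≤-<-trans (≤-trans (m≤m+n _ d) (≤-reflexive e′)) (toℕ<n j)
  i′ : Fin n
  i′ = fromℕ< i<n
  toℕ-i′ : toℕ i′ ≡ suc (toℕ i)
  toℕ-i′ = toℕ-fromℕ< i<n
  rest : ∃ λ k → Walk (Ext o) (suc i′) zero k
  rest = walkToAdded d i′ j (≡-trans (cong (_+ d) toℕ-i′) e′) oj

-- An arc from `s` to `i`, the path from `i` on to `j` and an arc from `j` back to `s` would close a
-- cycle.
acyclic⇒monotone : ∀ {o : Fin n → Bool} → Acyclic (Ext o) →
                   ∀ {i j} → toℕ i ≤ toℕ j → o i ≡ true → o j ≡ true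
acyclic⇒monotone {o = o} acyclic {i} {j} i≤j oi with o j in oj
... | true  = refl
... | false with k , w ← walkToAdded {o = o} (toℕ j ∸ toℕ i) i j (m+[n∸m]≡n i≤j) oj =
  contradiction (step oi w) (acyclic zero k)

threshold : ∀ n {o : Fin n → Bool} → (∀ {i j} → toℕ i ≤ toℕ j → o i ≡ true → o j ≡ true) →
            ∃₂ λ k l → n ≡ k + l × Threshold o k
threshold zero    _ = 0 , 0 , refl , record { below = λ () ; above = λ () }
threshold (suc n) {o} monotone with o zero in o₀
... | true  = 0 , suc n , refl , record { below = λ _ () ; above = λ i _ → monotone z≤n o₀ }
... | false with k , l , e , t ← threshold n {o ∘ suc} (λ i≤j → monotone (s≤s i≤j)) =
  suc k , l , cong suc e , record
    { below = λ { zero _ → o₀ ; (suc i) (s≤s i<k) → Threshold.below t i i<k }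
    ; above = λ { (suc i) (s≤s k≤i) → Threshold.above t i k≤i } }

-- Arithmetic of the two values, and the case distinction.

2[1+n]∸2≡n+n : ∀ n → 2 * suc n ∸ 2 ≡ n + n
2[1+n]∸2≡n+n n = cong (_∸ 2) (expand n)
  where
  expand : ∀ n → 2 * suc n ≡ 2 + (n + n)
  expand = solve-∀

-- At `n = 0` the truncated difference would break the identity.
1+[2[1+n]∸3]≡n+n : ∀ n → 1 ≤ n → suc (2 * suc n ∸ 3) ≡ n + n
1+[2[1+n]∸3]≡n+n (suc m) _ = ≡-trans (cong (λ k → suc (k ∸ 3)) (expand m)) (collect m)
  where
  expand : ∀ m → 2 * suc (suc m) ≡ 3 + (m + suc m)
  expand = solve-∀
  collect : ∀ m → suc (m + suc m) ≡ suc m + suc m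
  collect = solve-∀

-- One vertex on each side gives `TT3`; every other mixed split has `n ≥ 3`, as `extension`
-- requires.
isUnv-nonexceptional : ∀ a b {o : Fin (suc a + suc b) → Bool} → Threshold o (suc a) → ¬ Ext o ≅ TT3 →
                       IsUnv (Ext o) (2 * suc (suc a + suc b) ∸ 3)
isUnv-nonexceptional zero    zero    t ≇TT3 = contradiction (≅-TT3 t) ≇TT3
isUnv-nonexceptional zero    (suc b) t _    =
  isUnv-mixed t (s≤s (s≤s (s≤s z≤n))) (1+[2[1+n]∸3]≡n+n (3 + b) (s≤s z≤n))
isUnv-nonexceptional (suc a) b       t _    =
  isUnv-mixed t (s≤s (s≤s (≤-trans (s≤s z≤n) (m≤n+m (suc b) a)))) (1+[2[1+n]∸3]≡n+n (2 + a + suc b) (s≤s z≤n))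

theorem31 : (n : ℕ) → 1 ≤ n → (o : Fin n → Bool) → Acyclic (Ext o) →
    ((Source (Ext o) zero ⊎ Sink (Ext o) zero ⊎ Ext o ≅ TT3) →
    IsUnv (Ext o) (2 * suc n ∸ 2)) ×
    (¬ (Source (Ext o) zero ⊎ Sink (Ext o) zero ⊎ Ext o ≅ TT3) →
    IsUnv (Ext o) (2 * suc n ∸ 3))
theorem31 n 1≤n o acyclic with threshold n (acyclic⇒monotone acyclic)
... | zero , l , refl , t =
  (λ _ → subst (IsUnv (Ext o)) (sym (2[1+n]∸2≡n+n l)) (isUnv-source 1≤n t)) ,
  (λ none → contradiction (inj₁ source) none)
  where
  source : Source (Ext o) zero
  source (suc i) e = contradiction (≡-trans (sym e) (cong not (Threshold.above t i z≤n))) λ ()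
... | k@(suc _) , zero , refl , t =
  (λ _ → subst (IsUnv (Ext o)) (sym (2[1+n]∸2≡n+n (k + 0))) (isUnv-sink (s≤s z≤n) t)) ,
  (λ none → contradiction (inj₂ (inj₁ sink)) none)
  where
  sink : Sink (Ext o) zero
  sink (suc i) e = contradiction
    (≡-trans (sym e) (Threshold.below t i (≤-trans (toℕ<n i) (≤-reflexive (+-identityʳ k))))) λ ()
... | suc a , suc b , refl , t = exceptional , λ none → isUnv-nonexceptional a b t (none ∘ inj₂ ∘ inj₂)
  where
  exceptional : Source (Ext o) zero ⊎ Sink (Ext o) zero ⊎ Ext o ≅ TT3 → IsUnv (Ext o) (2 * suc n ∸ 2)
  -- Both sides of `s` are inhabited: path vertex 0 lies before `s` and path vertex `suc a` after
  -- it.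
  exceptional (inj₁ source)      =
    contradiction (cong not (Threshold.below t zero (s≤s z≤n))) (source (suc zero))
  exceptional (inj₂ (inj₁ sink)) = contradiction
    (Threshold.above t (suc a ↑ʳ zero)
      (≤-trans (m≤m+n (suc a) 0) (≤-reflexive (sym (toℕ-↑ʳ (suc a) zero)))))
    (sink (suc (suc a ↑ʳ zero)))
  exceptional (inj₂ (inj₂ iso))  = TT3-isUnv iso
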